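{- Let $\varphi:\{0,1\}^*\to\{0,1\}^*$ be a primitive non-uniform morphism and let $\mathbf{u}$ be an aperiodic fixed point of $\varphi$ such that the set of factors of $\mathbf{u}$ contains infinitely many palindromes as well as infinitely many antipalindromes. Then either $\varphi$ or $\varphi^2$ is a morphism in class $\mathcal{A}_2$ for which the word $\mathfrak{w}$ in its defining representation is an antipalindrome; i.e., there exist a nonempty antipalindrome $\mathfrak{w}$ and $k,h\in\mathbb{N}$ such that $\psi(0)=\Theta\big(\mathfrak{w}(\mathrm{R}(\mathfrak{w})\mathfrak{w})^k\big)$ and $\psi(1)=\Theta\big((\mathrm{R}(\mathfrak{w})\mathfrak{w})^h\mathrm{R}(\mathfrak{w})\big)$, where $\psi=\varphi$ or $\psi=\varphi^2$.
   Context: Words are over $\{0,1\}$, $\varepsilon$ the empty word, $\mathbb{N}=\{0,1,2,\dots\}$. $\mathrm{R}$ is the mirror image antimorphism $\mathrm{R}(w_1\cdots w_n)=w_n\cdots w_1$; $w$ is a palindrome if $\mathrm{R}(w)=w$. $\mathrm{E}$ is the antimorphism $\mathrm{E}(w_1\cdots w_n)=(1-w_n)\cdots(1-w_1)$; $w$ is an antipalindrome if $\mathrm{E}(w)=w$. $\Theta$ is the Thue–Morse morphism $\Theta(0)=01$, $\Theta(1)=10$. A morphism is primitive if some power maps every letter to a word containing both letters; uniform if $|\varphi(0)|=|\varphi(1)|$. A fixed point is an infinite word $\mathbf{u}$ with $\varphi(\mathbf{u})=\mathbf{u}$; aperiodic means not eventually periodic. Class $\mathcal{A}_2$: morphisms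 $\psi$ for which there exist a nonempty word $\mathfrak{w}$ and $k,h\in\mathbb{N}$ with $\psi(0)=\Theta(\mathfrak{w}(\mathrm{R}(\mathfrak{w})\mathfrak{w})^k)$, $\psi(1)=\Theta((\mathrm{R}(\mathfrak{w})\mathfrak{w})^h\mathrm{R}(\mathfrak{w}))$. -}

module Defs where

open import Data.Bool using (Bool; true; false; not)
open import Data.Nat using (ℕ; zero; suc; _+_; _<_; _≤_)
open import Data.List using (List; []; _∷_; _++_; length; reverse; map; concatMap; take; drop)
open import Data.List.Membership.Propositional using (_∈_)
open import Data.Product using (Σ; ∃; _×_; _,_)
open import Relation.Binary.PropositionalEquality using (_≡_)
open import Relation.Nullary using (¬_)

-- Alphabet {0,1} is represented by Bool with false = 0, true = 1.
Word : Set
Word = List Bool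

InfWord : Set
InfWord = ℕ → Bool

-- A morphism of {0,1}* is determined by the images of the letters.
Morphism : Set
Morphism = Bool → Word

img : Morphism → Word → Word
img φ w = concatMap φ w

pow : Morphism → ℕ → Morphism
pow φ zero b = b ∷ []
pow φ (suc n) b = img φ (pow φ n b)

R : Word → Word
R = reverse

E : Word → Word
E w = reverse (map not w)

IsPalindrome : Word → Set
IsPalindrome w = R w ≡ w

IsAntipalindrome : Word → Set
IsAntipalindrome w = E w ≡ w

Θ : Morphism
Θ false = false ∷ true ∷ []
Θ true  = true ∷ false ∷ []

ΘW : Word → Word
ΘW = img Θ

_^ʷ_ : Word → ℕ → Word
w ^ʷ zero = []
w ^ʷ suc k = w ++ (w ^ʷ k)

pref : InfWord → ℕ → Word
pref u zero = []
pref u (suc n) = pref u n ++ (u n ∷ [])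

shift : InfWord → ℕ → InfWord
shift u i j = u (i + j)

IsPrefixOf : Word → InfWord → Set
IsPrefixOf w u = pref u (length w) ≡ w

IsFactor : Word → InfWord → Set
IsFactor w u = ∃ λ i → IsPrefixOf w (shift u i)

IsPrimitive : Morphism → Set
IsPrimitive φ = ∃ λ k → (b c : Bool) → c ∈ pow φ k b

IsUniform : Morphism → Set
IsUniform φ = length (φ false) ≡ length (φ true)

-- φ(u) = u.  For a non-erasing morphism φ(u) is the infinite word having
-- φ(u₀⋯u_{n-1}) as a prefix for every n; so φ(u) = u iff every
-- φ(pref u n) is a prefix of u.
IsFixedPoint : Morphism → InfWord → Set
IsFixedPoint φ u = (n : ℕ) → IsPrefixOf (img φ (pref u n)) u

IsEventuallyPeriodic : InfWord → Set
IsEventuallyPeriodic u =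
  ∃ λ p → ∃ λ N → (0 < p) × ((i : ℕ) → N ≤ i → u (i + p) ≡ u i)

IsAperiodic : InfWord → Set
IsAperiodic u = ¬ IsEventuallyPeriodic u

-- The set of factors of u satisfying P is infinite (binary alphabet:
-- infinitely many words ⇔ arbitrarily long ones).
InfinitelyManyFactors : (Word → Set) → InfWord → Set
InfinitelyManyFactors P u = (n : ℕ) → ∃ λ w → (n ≤ length w) × IsFactor w u × P w

InA2WithAntipalindrome : Morphism → Set
InA2WithAntipalindrome ψ =
  ∃ λ (𝔴 : Word) → ∃ λ (k : ℕ) → ∃ λ (h : ℕ) →
    (¬ (𝔴 ≡ [])) × IsAntipalindrome 𝔴 ×
    (ψ false ≡ ΘW (𝔴 ++ ((R 𝔴 ++ 𝔴) ^ʷ k))) ×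
    (ψ true ≡ ΘW (((R 𝔴 ++ 𝔴) ^ʷ h) ++ R 𝔴))

{-# OPTIONS --safe #-}
module Submission where

-- The language of u is uniformly recurrent, so the palindromes and antipalindromes make it
-- invariant under R, E and the exchange of letters. Since the complexity of u is linear, there
-- are finitely many left special infinite words, and w ↦ sχ(w) permutes them for every morphism χ
-- preserving the language (s a longest common suffix). Invariance under the exchange of letters
-- forces s = ε and then distinct first letters of χ(0) and χ(1), so there are exactly two left
-- special infinite words, which are exchanged by complementation and fixed by every χ for which
-- χ(b) begins with b. Let χ be φ or its complement, whichever has this property. Comparing χ with
-- its mirror image shows that χ(0) and χ(1) are palindromes, or both antipalindromes. Comparing χ
-- with its conjugate by the exchange of letters on prefixes of the left special words gives
-- χ(0) = r(r̄r)ᵏ, χ(1) = r̄(rr̄)ʰ with r = Θ(w); non-uniformity enters here, making one of χ(0) and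
-- the complement of χ(1) a proper prefix of the other. This form makes φ² belong to the class.

open import Defs
open import Data.Bool using (Bool; true; false; not; if_then_else_)
open import Data.Bool.Properties as Bool using (not-involutive; not-¬)
open import Data.Empty using (⊥; ⊥-elim)
open import Data.List using (List; []; _∷_; [_]; _++_; length; reverse; map; take; drop)
open import Data.List.Membership.Propositional using (_∈_)
open import Data.List.Membership.Propositional.Properties using (∈-∃++)
open import Data.List.Properties
open import Data.List.Relation.Unary.All as All using (All; []; _∷_)
import Data.List.Relation.Unary.All.Properties as All
open import Data.List.Relation.Unary.AllPairs as AllPairs using (AllPairs; []; _∷_)
import Data.List.Relation.Unary.AllPairs.Properties as AllPairs
open import Data.List.Relation.Unary.Any using (here; there)
open import Data.Nat using (ℕ; zero; suc; _+_; _*_; _∸_; _^_; _<_; _≤_; z≤n; s≤s; s≤s⁻¹; _⊔_)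
open import Data.Nat.Properties hiding (_≟_)
open import Data.Product using (∃; ∃₂; _×_; _,_; proj₁; proj₂)
open import Data.Sum using (_⊎_; inj₁; inj₂; swap)
open import Function using (_∘_; case_of_)
open import Relation.Binary.Definitions using (tri<; tri≈; tri>)
open import Relation.Binary.PropositionalEquality hiding ([_])
open import Relation.Nullary using (¬_; Dec; yes; no; does)
open import Relation.Nullary.Decidable using (decidable-stable)
open import Tactic.MonoidSolver using (solve)

-- The left special infinite words are never constructed. A prefix of the one beginning with c is
-- encoded as a word that begins all sufficiently long left special words starting with c, and the
-- permutation becomes a statement about returns: a given prefix of a long left special w is again a
-- prefix of some later image of w. This follows by pigeonhole, since a collision of two orbit
-- points can be pulled back to w through the injectivity of χ on long words. The mirror image of χ
-- also preserves the language, so it or its complement sends each letter to a word beginning with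
-- that letter, and it fixes the same two infinite words. Thus χ(b) and its mirror image,
-- complemented or not, are prefixes of equal length of one infinite word, hence equal. Θ appears
-- because χ and its conjugate agree on 01 and on 10 but map 00, and likewise 11, to words neither
-- of which is a prefix of the other: the common fixed infinite word must be cut into blocks 01 and
-- 10.

-- Complementation, powers, antimorphisms and morphisms

bar : Word → Word
bar = map not

bar-++ : ∀ x y → bar (x ++ y) ≡ bar x ++ bar y
bar-++ = map-++ not

bar-involutive : ∀ w → bar (bar w) ≡ w
bar-involutive []      = refl
bar-involutive (a ∷ w) = cong₂ _∷_ (not-involutive a) (bar-involutive w)

bar-injective : ∀ {v w} → bar v ≡ bar w → v ≡ w
bar-injective {v} {w} eq = trans (sym (bar-involutive v)) (trans (cong bar eq) (bar-involutive w))

length-bar : ∀ w → length (bar w) ≡ length w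
length-bar = length-map not

reverse-bar : ∀ w → reverse (bar w) ≡ bar (reverse w)
reverse-bar w = sym (reverse-map not w)

bar-fixed⇒[] : ∀ {w} → w ≡ bar w → w ≡ []
bar-fixed⇒[] {[]}    _  = refl
bar-fixed⇒[] {a ∷ w} eq = ⊥-elim (not-¬ refl (∷-injectiveˡ eq))

≢⇒≡not : ∀ {a b} → a ≢ b → b ≡ not a
≢⇒≡not {false} {false} a≢b = ⊥-elim (a≢b refl)
≢⇒≡not {false} {true}  _   = refl
≢⇒≡not {true}  {false} _   = refl
≢⇒≡not {true}  {true}  a≢b = ⊥-elim (a≢b refl)

_≟ʷ_ : (v w : Word) → Dec (v ≡ w)
_≟ʷ_ = ≡-dec Bool._≟_

^ʷ-+ : ∀ v m n → v ^ʷ (m + n) ≡ v ^ʷ m ++ v ^ʷ n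
^ʷ-+ v zero    n = refl
^ʷ-+ v (suc m) n = trans (cong (v ++_) (^ʷ-+ v m n)) (sym (++-assoc v _ _))

^ʷ-* : ∀ v m n → v ^ʷ (n * m) ≡ (v ^ʷ m) ^ʷ n
^ʷ-* v m zero    = refl
^ʷ-* v m (suc n) = trans (^ʷ-+ v m (n * m)) (cong (v ^ʷ m ++_) (^ʷ-* v m n))

^ʷ-slide : ∀ x y n → (x ++ y) ^ʷ n ++ x ≡ x ++ (y ++ x) ^ʷ n
^ʷ-slide x y zero    = sym (++-identityʳ x)
^ʷ-slide x y (suc n) = begin
  ((x ++ y) ++ (x ++ y) ^ʷ n) ++ x ≡⟨ ++-assoc (x ++ y) _ x ⟩
  (x ++ y) ++ (x ++ y) ^ʷ n ++ x   ≡⟨ cong ((x ++ y) ++_) (^ʷ-slide x y n) ⟩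
  (x ++ y) ++ x ++ (y ++ x) ^ʷ n   ≡⟨ solve (++-monoid Bool) ⟩
  x ++ (y ++ x) ++ (y ++ x) ^ʷ n   ∎
  where open ≡-Reasoning

^ʷ-comm : ∀ v n → v ^ʷ n ++ v ≡ v ++ v ^ʷ n
^ʷ-comm v n = begin
  v ^ʷ n ++ v         ≡⟨ cong (λ z → z ^ʷ n ++ v) (sym (++-identityʳ v)) ⟩
  (v ++ []) ^ʷ n ++ v ≡⟨ ^ʷ-slide v [] n ⟩
  v ++ v ^ʷ n         ∎
  where open ≡-Reasoning

bar-^ʷ : ∀ v n → bar (v ^ʷ n) ≡ bar v ^ʷ n
bar-^ʷ v zero    = refl
bar-^ʷ v (suc n) = trans (bar-++ v _) (cong (bar v ++_) (bar-^ʷ v n))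

-- Shared by `R` and `E`, so that the palindromic and the antipalindromic case run through the same
-- arguments.
Anti : (Word → Word) → Set
Anti ρ = ∀ x y → ρ (x ++ y) ≡ ρ y ++ ρ x

anti-[] : ∀ ρ → Anti ρ → ρ [] ≡ []
anti-[] ρ anti = ++-identityʳ-unique (ρ []) (anti [] [])

anti-^ʷ : ∀ ρ → Anti ρ → ∀ v n → ρ (v ^ʷ n) ≡ ρ v ^ʷ n
anti-^ʷ ρ anti v zero = anti-[] ρ anti
anti-^ʷ ρ anti v (suc n) = begin
  ρ (v ++ v ^ʷ n)       ≡⟨ anti v (v ^ʷ n) ⟩
  ρ (v ^ʷ n) ++ ρ v     ≡⟨ cong (_++ ρ v) (anti-^ʷ ρ anti v n) ⟩
  ρ v ^ʷ n ++ ρ v       ≡⟨ ^ʷ-comm (ρ v) n ⟩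
  ρ v ++ ρ v ^ʷ n       ∎
  where open ≡-Reasoning

E-anti : Anti E
E-anti x y = trans (cong reverse (bar-++ x y)) (reverse-++ (bar x) (bar y))

length-E : ∀ w → length (E w) ≡ length w
length-E w = trans (length-reverse (bar w)) (length-bar w)

E-bar : ∀ w → E (bar w) ≡ bar (E w)
E-bar w = reverse-bar (bar w)

img-++ : ∀ φ x y → img φ (x ++ y) ≡ img φ x ++ img φ y
img-++ = concatMap-++

img-letter : ∀ φ a → img φ [ a ] ≡ φ a
img-letter φ a = ++-identityʳ (φ a)

img-pair : ∀ φ a b → img φ (a ∷ b ∷ []) ≡ φ a ++ φ b
img-pair φ a b = cong (φ a ++_) (img-letter φ b)

img-^ʷ : ∀ φ v n → img φ (v ^ʷ n) ≡ img φ v ^ʷ n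
img-^ʷ φ v zero    = refl
img-^ʷ φ v (suc n) = trans (img-++ φ v _) (cong (img φ v ++_) (img-^ʷ φ v n))

img-cong : ∀ {φ ψ} → (∀ b → φ b ≡ ψ b) → ∀ w → img φ w ≡ img ψ w
img-cong = concatMap-cong

img-∘ : ∀ φ ψ w → img φ (img ψ w) ≡ img (λ b → img φ (ψ b)) w
img-∘ φ ψ []      = refl
img-∘ φ ψ (a ∷ w) = trans (img-++ φ (ψ a) _) (cong (img φ (ψ a) ++_) (img-∘ φ ψ w))

img-anti : ∀ ρ → Anti ρ → ∀ φ w → img (λ b → ρ (φ b)) w ≡ ρ (img φ (reverse w))
img-anti ρ anti φ []      = sym (anti-[] ρ anti)
img-anti ρ anti φ (a ∷ w) = begin
  ρ (φ a) ++ img (λ b → ρ (φ b)) w       ≡⟨ cong₂ (λ x y → ρ x ++ y) (sym (img-letter φ a)) (img-anti ρ anti φ w) ⟩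
  ρ (img φ [ a ]) ++ ρ (img φ (reverse w)) ≡⟨ sym (anti (img φ (reverse w)) (img φ [ a ])) ⟩
  ρ (img φ (reverse w) ++ img φ [ a ])   ≡⟨ cong ρ (sym (img-++ φ (reverse w) [ a ])) ⟩
  ρ (img φ (reverse w ++ [ a ]))         ≡⟨ cong (ρ ∘ img φ) (sym (unfold-reverse a w)) ⟩
  ρ (img φ (reverse (a ∷ w)))            ∎
  where open ≡-Reasoning

bar-img : ∀ φ w → bar (img φ w) ≡ img (bar ∘ φ) w
bar-img φ = map-concatMap not φ

img-bar : ∀ φ w → img φ (bar w) ≡ img (φ ∘ not) w
img-bar φ []      = refl
img-bar φ (a ∷ w) = cong (φ (not a) ++_) (img-bar φ w)

infix 10 _′
-- Conjugation by the exchange of letters. It preserves every complement-closed language that φ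
-- preserves, and it exchanges the lengths of the two images.
_′ : Morphism → Morphism
(φ ′) b = bar (φ (not b))

img-′ : ∀ φ w → img (φ ′) w ≡ bar (img φ (bar w))
img-′ φ w = sym (trans (cong bar (img-bar φ w)) (bar-img (φ ∘ not) w))

-- Prefixes, comparability and factors

levi : ∀ (v w : Word) {s t} → v ++ s ≡ w ++ t →
       (∃ λ z → w ≡ v ++ z × s ≡ z ++ t) ⊎ (∃ λ z → v ≡ w ++ z × t ≡ z ++ s)
levi []      w       eq = inj₁ (w , refl , eq)
levi (a ∷ v) []      eq = inj₂ (a ∷ v , refl , sym eq)
levi (a ∷ v) (b ∷ w) eq with ∷-injective eq
... | refl , eq′ with levi v w eq′
... | inj₁ (z , p , q) = inj₁ (z , cong (a ∷_) p , q)
... | inj₂ (z , p , q) = inj₂ (z , cong (a ∷_) p , q)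

++-split : ∀ (v w : Word) {s t} → v ++ s ≡ w ++ t → length v ≡ length w → v ≡ w × s ≡ t
++-split []      []      eq _  = refl , eq
++-split (a ∷ v) (b ∷ w) eq le with ∷-injective eq
... | refl , eq′ with ++-split v w eq′ (suc-injective le)
... | refl , eq″ = refl , eq″

++-splitʳ : ∀ (v w : Word) {s t} → v ++ s ≡ w ++ t → length s ≡ length t → v ≡ w × s ≡ t
++-splitʳ v w {s} {t} eq le = ++-split v w eq
  (+-cancelʳ-≡ (length s) (length v) (length w)
    (trans (sym (length-++ v)) (trans (cong length eq) (trans (length-++ w) (cong (length w +_) (sym le))))))

infix 4 _≼_ _⊑_

_≼_ : Word → Word → Set
v ≼ w = ∃ λ t → v ++ t ≡ w

≼-trans : ∀ {u v w} → u ≼ v → v ≼ w → u ≼ w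
≼-trans {u} (s , refl) (t , refl) = s ++ t , sym (++-assoc u s t)

≼-++ : ∀ v {t} → v ≼ v ++ t
≼-++ v {t} = t , refl

≼-length : ∀ {v w} → v ≼ w → length v ≤ length w
≼-length {v} (t , refl) = length-++-≤ˡ v

++-mono-≼ : ∀ x {v w} → v ≼ w → x ++ v ≼ x ++ w
++-mono-≼ x {v} (t , refl) = t , ++-assoc x v t

++-cancel-≼ : ∀ x {v w} → x ++ v ≼ x ++ w → v ≼ w
++-cancel-≼ x {v} (t , eq) = t , ++-cancelˡ x _ _ (trans (sym (++-assoc x v t)) eq)

img-mono-≼ : ∀ φ {v w} → v ≼ w → img φ v ≼ img φ w
img-mono-≼ φ {v} (t , refl) = img φ t , sym (img-++ φ v t)

∷-≼⁻ : ∀ {a b v w} → a ∷ v ≼ b ∷ w → a ≡ b × v ≼ w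
∷-≼⁻ (t , eq) = ∷-injectiveˡ eq , t , ∷-injectiveʳ eq

_≼?_ : ∀ v w → Dec (v ≼ w)
[]      ≼? w  = yes (w , refl)
(a ∷ v) ≼? [] = no λ ()
(a ∷ v) ≼? (b ∷ w) with a Bool.≟ b | v ≼? w
... | yes refl | yes (t , refl) = yes (t , refl)
... | yes refl | no v⋠w = no (v⋠w ∘ proj₂ ∘ ∷-≼⁻)
... | no a≢b   | _      = no (a≢b ∘ proj₁ ∘ ∷-≼⁻)

Comparable : Word → Word → Set
Comparable v w = v ≼ w ⊎ w ≼ v

prefixes-comparable : ∀ {u v w} → v ≼ w → u ≼ w → Comparable u v
prefixes-comparable {u} {v} (t , refl) (s , eq) with levi u v eq
... | inj₁ (z , refl , _) = inj₁ (z , refl)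
... | inj₂ (z , refl , _) = inj₂ (z , refl)

comparable-++ : ∀ x {v w} → Comparable (x ++ v) (x ++ w) → Comparable v w
comparable-++ x (inj₁ p) = inj₁ (++-cancel-≼ x p)
comparable-++ x (inj₂ p) = inj₂ (++-cancel-≼ x p)

comparable-sym : ∀ {v w} → Comparable v w → Comparable w v
comparable-sym = swap

comparable-∷ : ∀ {a b v w} → Comparable (a ∷ v) (b ∷ w) → a ≡ b
comparable-∷ (inj₁ p) = proj₁ (∷-≼⁻ p)
comparable-∷ (inj₂ p) = sym (proj₁ (∷-≼⁻ p))

comparable-length : ∀ {v w} → Comparable v w → length v ≤ length w → v ≼ w
comparable-length (inj₁ p) _ = p
comparable-length {v} {w} (inj₂ ([] , refl)) _ = [] , trans (++-identityʳ _) (++-identityʳ w)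
comparable-length {v} {w} (inj₂ (a ∷ t , refl)) le =
  ⊥-elim (<⇒≱ (subst (length w <_) (sym (length-++ w)) (m<m+n (length w) (s≤s z≤n))) le)

comparable-≡ : ∀ {v w} → Comparable v w → length v ≡ length w → v ≡ w
comparable-≡ {v} {w} c le with comparable-length c (≤-reflexive le)
... | t , eq = proj₁ (++-split v w (trans eq (sym (++-identityʳ w))) le)

comparable-≼ : ∀ {u v w} → u ≼ v → Comparable v w → Comparable u w
comparable-≼ p (inj₁ q) = inj₁ (≼-trans p q)
comparable-≼ p (inj₂ q) = prefixes-comparable q p

comparable? : ∀ v w → Dec (Comparable v w)
comparable? v w with v ≼? w | w ≼? v
... | yes p | _     = yes (inj₁ p)
... | no _  | yes q = yes (inj₂ q)
... | no ¬p | no ¬q = no λ { (inj₁ p) → ¬p p ; (inj₂ q) → ¬q q }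

_⊑_ : Word → Word → Set
v ⊑ w = ∃₂ λ x y → w ≡ x ++ v ++ y

⊑-refl : ∀ {v} → v ⊑ v
⊑-refl = [] , [] , sym (++-identityʳ _)

⊑-trans : ∀ {u v w} → u ⊑ v → v ⊑ w → u ⊑ w
⊑-trans {u} (x , y , refl) (x′ , y′ , refl) = x′ ++ x , y ++ y′ , solve (++-monoid Bool)

≼⇒⊑ : ∀ {v w} → v ≼ w → v ⊑ w
≼⇒⊑ (t , refl) = [] , t , refl

⊑-++ˡ : ∀ x {v w} → v ⊑ w → v ⊑ x ++ w
⊑-++ˡ x {v} (y , z , refl) = x ++ y , z , sym (++-assoc x y (v ++ z))

img-mono-⊑ : ∀ φ {v w} → v ⊑ w → img φ v ⊑ img φ w
img-mono-⊑ φ {v} (x , y , refl) = img φ x , img φ y ,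
  trans (img-++ φ x (v ++ y)) (cong (img φ x ++_) (img-++ φ v y))

anti-mono-⊑ : ∀ ρ → Anti ρ → ∀ {v w} → v ⊑ w → ρ v ⊑ ρ w
anti-mono-⊑ ρ anti {v} (x , y , refl) = ρ y , ρ x ,
  trans (anti x (v ++ y)) (trans (cong (_++ ρ x) (anti v y)) (++-assoc (ρ y) (ρ v) (ρ x)))

Starts : Bool → Word → Set
Starts a w = ∃ λ t → w ≡ a ∷ t

-- Words conjugate to their complement

∷≢[] : ∀ {a : Bool} {w : Word} → a ∷ w ≢ []
∷≢[] ()

length-<-++ˡ : ∀ {x : Word} → x ≢ [] → ∀ w → length w < length (x ++ w)
length-<-++ˡ {[]}    x≢[] w = ⊥-elim (x≢[] refl)
length-<-++ˡ {a ∷ x} _    w = s≤s (length-++-≤ʳ w {x})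

splitAtʷ : ∀ m (w : Word) → m ≤ length w → ∃₂ λ x y → w ≡ x ++ y × length x ≡ m
splitAtʷ m w m≤w = take m w , drop m w , sym (take++drop≡id m w) ,
                   trans (length-take m w) (m≤n⇒m⊓n≡m m≤w)

-- Sliding v through ȳ turns (vv̄)ʰv(v̄v)ʰv̄ into a power with the odd exponent 2h + 1. The descent
-- below reassembles its t from such products.
++-bar-palindromic : ∀ v h → let y = (v ++ bar v) ^ʷ h ++ v in
                     y ++ bar y ≡ (v ++ bar v) ^ʷ (h + suc h)
++-bar-palindromic v h = begin
  (p ++ v) ++ bar (p ++ v)                   ≡⟨ cong ((p ++ v) ++_) bar-y ⟩
  (p ++ v) ++ (bar v ++ v) ^ʷ h ++ bar v     ≡⟨ ++-assoc p v _ ⟩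
  p ++ v ++ (bar v ++ v) ^ʷ h ++ bar v       ≡⟨ cong (p ++_) (sym (++-assoc v _ (bar v))) ⟩
  p ++ (v ++ (bar v ++ v) ^ʷ h) ++ bar v     ≡⟨ cong (λ z → p ++ z ++ bar v) (sym (^ʷ-slide v (bar v) h)) ⟩
  p ++ (p ++ v) ++ bar v                     ≡⟨ cong (p ++_) (++-assoc p v (bar v)) ⟩
  p ++ p ++ v ++ bar v                       ≡⟨ cong (p ++_) (^ʷ-comm (v ++ bar v) h) ⟩
  p ++ (v ++ bar v) ^ʷ suc h                 ≡⟨ sym (^ʷ-+ (v ++ bar v) h (suc h)) ⟩
  (v ++ bar v) ^ʷ (h + suc h)                ∎
  where
  open ≡-Reasoning
  p = (v ++ bar v) ^ʷ h
  bar-y : bar (p ++ v) ≡ (bar v ++ v) ^ʷ h ++ bar v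
  bar-y = trans (bar-++ p v) (cong (_++ bar v) (trans (bar-^ʷ (v ++ bar v) h)
    (cong (_^ʷ h) (trans (bar-++ v (bar v)) (cong (bar v ++_) (bar-involutive v))))))

reassoc : ∀ (x y z : Word) → (x ++ y) ++ z ++ x ≡ (x ++ y ++ z) ++ x
reassoc x y z = solve (++-monoid Bool)

-- A Euclidean descent on the lengths of t and y.
conjugate-of-bar : ∀ n t y → length (t ++ y) ≤ n → t ≢ [] → y ≢ [] → t ++ y ≡ y ++ bar t →
  ∃ λ v → ∃₂ λ m h → t ≡ (v ++ bar v) ^ʷ suc m × y ≡ (v ++ bar v) ^ʷ h ++ v
conjugate-of-bar zero t y le t≢[] _ _ = ⊥-elim (t≢[] (++-conicalˡ t y (length≡0 (n≤0⇒n≡0 le))))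
  where
  length≡0 : ∀ {w : Word} → length w ≡ 0 → w ≡ []
  length≡0 {[]} _ = refl
conjugate-of-bar (suc n) t y le t≢[] y≢[] eq with levi t y eq
-- Here y = tz, and cancelling t leaves tz = zt̄, the same equation for a shorter y. An empty z
-- would make t its own complement.
... | inj₁ ([] , refl , q) = ⊥-elim (t≢[] (bar-fixed⇒[] (trans (sym (++-identityʳ t)) q)))
... | inj₁ (z@(_ ∷ _) , refl , q)
    with conjugate-of-bar n t z (s≤s⁻¹ (≤-trans (length-<-++ˡ t≢[] (t ++ z)) le)) t≢[] ∷≢[] q
... | v , m , h , t≡ , z≡ = v , m , suc m + h , t≡ ,
      trans (cong₂ _++_ t≡ z≡) (trans (sym (++-assoc ((v ++ bar v) ^ʷ suc m) _ v))
        (cong (_++ v) (sym (^ʷ-+ (v ++ bar v) (suc m) h))))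
conjugate-of-bar (suc n) t y le t≢[] y≢[] eq | inj₂ (z , refl , q)
    with levi (bar y) z (trans (sym (bar-++ y z)) q)
... | inj₁ ([] , refl , _) rewrite ++-identityʳ (bar y) =
      y , 0 , 0 , sym (++-identityʳ _) , refl
-- Now t = yȳz₁, and complementing what remains gives z₁y = yz̄₁.
... | inj₁ (z₁@(_ ∷ _) , refl , s)
    with conjugate-of-bar n z₁ y
           (s≤s⁻¹ (≤-trans (subst (λ w → length (z₁ ++ y) < length w) (reassoc y (bar y) z₁)
             (length-<-++ˡ {y ++ bar y} (λ e → y≢[] (++-conicalˡ y (bar y) e)) (z₁ ++ y))) le))
           ∷≢[] y≢[]
           (trans (sym s) (trans (bar-++ (bar y) z₁) (cong (_++ bar z₁) (bar-involutive y))))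
... | v , m , h , z≡ , y≡ = v , h + suc h + m , h ,
      (begin
         y ++ bar y ++ z₁                                         ≡⟨ sym (++-assoc y (bar y) z₁) ⟩
         (y ++ bar y) ++ z₁                                       ≡⟨ cong (λ w → (w ++ bar w) ++ z₁) y≡ ⟩
         (y′ ++ bar y′) ++ z₁                                     ≡⟨ cong₂ _++_ (++-bar-palindromic v h) z≡ ⟩
         (v ++ bar v) ^ʷ (h + suc h) ++ (v ++ bar v) ^ʷ suc m     ≡⟨ sym (^ʷ-+ (v ++ bar v) (h + suc h) (suc m)) ⟩
         (v ++ bar v) ^ʷ (h + suc h + suc m)                      ≡⟨ cong ((v ++ bar v) ^ʷ_) (+-suc (h + suc h) m) ⟩
         (v ++ bar v) ^ʷ suc (h + suc h + m)                      ∎)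
      , y≡
      where
      open ≡-Reasoning
      y′ = (v ++ bar v) ^ʷ h ++ v
conjugate-of-bar (suc n) t y le t≢[] y≢[] eq | inj₂ (z , refl , q) | inj₂ (z₁ , ȳ≡ , y≡) with z₁
... | [] = y , 0 , 0 , trans (cong (y ++_) (trans (sym (++-identityʳ z)) (sym ȳ≡))) (sym (++-identityʳ _)) , refl
-- Now y = z₁z̄, while ȳ = zz₁ gives y = z̄z̄₁; so z₁ and z̄ satisfy the equation.
... | z₁@(_ ∷ _)
    with conjugate-of-bar n z₁ (bar z)
           (s≤s⁻¹ (≤-trans (subst (λ w → length (z₁ ++ bar z) < length ((y ++ z) ++ w)) (sym y≡)
             (length-<-++ˡ {y ++ z} (λ e → y≢[] (++-conicalˡ y z e)) (z₁ ++ bar z))) le))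
           ∷≢[] z̄≢[]
           (trans (sym y≡) (trans (sym (bar-involutive y)) (trans (cong bar ȳ≡) (bar-++ z z₁))))
  where
  z̄≢[] : bar z ≢ []
  z̄≢[] e = y≢[] (bar-fixed⇒[] (trans y≡ (trans (cong (z₁ ++_) e) (trans (++-identityʳ z₁)
    (sym (trans ȳ≡ (cong (_++ z₁) (bar-injective e))))))))
... | v , m , h , z₁≡ , z̄≡ = v , m + (h + suc h) , suc m + h ,
      (begin
         y ++ z                                    ≡⟨ cong (_++ z) y≡ ⟩
         (z₁ ++ bar z) ++ z                        ≡⟨ ++-assoc z₁ (bar z) z ⟩
         z₁ ++ bar z ++ z                          ≡⟨ cong (λ w → z₁ ++ bar z ++ w) (sym (bar-involutive z)) ⟩
         z₁ ++ bar z ++ bar (bar z)                ≡⟨ cong₂ (λ u w → u ++ w ++ bar w) z₁≡ z̄≡ ⟩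
         (v ++ bar v) ^ʷ suc m ++ y′ ++ bar y′     ≡⟨ cong ((v ++ bar v) ^ʷ suc m ++_) (++-bar-palindromic v h) ⟩
         (v ++ bar v) ^ʷ suc m ++ (v ++ bar v) ^ʷ (h + suc h) ≡⟨ sym (^ʷ-+ (v ++ bar v) (suc m) (h + suc h)) ⟩
         (v ++ bar v) ^ʷ (suc m + (h + suc h))     ∎) ,
      trans y≡ (trans (cong₂ _++_ z₁≡ z̄≡) (trans (sym (++-assoc ((v ++ bar v) ^ʷ suc m) _ v))
        (cong (_++ v) (sym (^ʷ-+ (v ++ bar v) (suc m) h)))))
      where
      open ≡-Reasoning
      y′ = (v ++ bar v) ^ʷ h ++ v

-- A word fixed by f and by its complement

starts-clash : ∀ {a v w} → Starts a v → Starts (not a) w → ¬ Comparable v w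
starts-clash (_ , refl) (_ , refl) c = not-¬ refl (comparable-∷ c)

starts-++ : ∀ {a v} → Starts a v → ∀ w → Starts a (v ++ w)
starts-++ (t , refl) w = t ++ w , refl

starts-bar : ∀ {a v} → Starts a v → Starts (not a) (bar v)
starts-bar (t , refl) = bar t , refl

starts-++⁻ : ∀ {a v w} → v ≢ [] → Starts a (v ++ w) → Starts a v
starts-++⁻ {v = []}    v≢[] _          = ⊥-elim (v≢[] refl)
starts-++⁻ {v = b ∷ v} _    (_ , refl) = v , refl

zeros-or-one : ∀ w → All (_≡ false) w ⊎ ∃₂ λ j w′ → w ≡ [ false ] ^ʷ j ++ true ∷ w′
zeros-or-one []          = inj₁ []
zeros-or-one (true ∷ w)  = inj₂ (0 , w , refl)
zeros-or-one (false ∷ w) with zeros-or-one w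
... | inj₁ zs           = inj₁ (refl ∷ zs)
... | inj₂ (j , w′ , p) = inj₂ (suc j , w′ , cong (false ∷_) p)

^ʷ-distrib : ∀ x y → x ++ y ≡ y ++ x → ∀ n → (x ++ y) ^ʷ n ≡ x ^ʷ n ++ y ^ʷ n
^ʷ-distrib x y xy≡yx zero    = refl
^ʷ-distrib x y xy≡yx (suc n) = begin
  (x ++ y) ++ (x ++ y) ^ʷ n     ≡⟨ cong ((x ++ y) ++_) (^ʷ-distrib x y xy≡yx n) ⟩
  (x ++ y) ++ x ^ʷ n ++ y ^ʷ n  ≡⟨ ++-assoc x y _ ⟩
  x ++ y ++ x ^ʷ n ++ y ^ʷ n    ≡⟨ cong (x ++_) (sym (++-assoc y (x ^ʷ n) _)) ⟩
  x ++ (y ++ x ^ʷ n) ++ y ^ʷ n  ≡⟨ cong (λ z → x ++ z ++ y ^ʷ n) (yxⁿ n) ⟩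
  x ++ (x ^ʷ n ++ y) ++ y ^ʷ n  ≡⟨ cong (x ++_) (++-assoc (x ^ʷ n) y _) ⟩
  x ++ x ^ʷ n ++ y ++ y ^ʷ n    ≡⟨ sym (++-assoc x (x ^ʷ n) _) ⟩
  x ^ʷ suc n ++ y ^ʷ suc n      ∎
  where
  open ≡-Reasoning
  yxⁿ : ∀ n → y ++ x ^ʷ n ≡ x ^ʷ n ++ y
  yxⁿ zero    = ++-identityʳ y
  yxⁿ (suc n) = trans (sym (++-assoc y x (x ^ʷ n))) (trans (cong (_++ x ^ʷ n) (sym xy≡yx))
    (trans (++-assoc x y (x ^ʷ n)) (trans (cong (x ++_) (yxⁿ n)) (sym (++-assoc x (x ^ʷ n) y)))))

OddCut : Word → Word → Set
OddCut r t = ∃₂ λ z₁ a → ∃ λ z₂ → r ≡ ΘW z₁ ++ [ a ] × t ≡ not a ∷ ΘW z₂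

-- An odd cut falls inside a block Θ(b), whose two letters are complementary. It is applied to rr̄
-- cut in the middle when |r| is odd.
odd-cut : ∀ q r t z → length r ≡ suc (q + q) → r ++ t ≡ ΘW z → OddCut r t
odd-cut zero (a ∷ []) t (false ∷ z) _ refl = [] , a , z , refl , refl
odd-cut zero (a ∷ []) t (true  ∷ z) _ refl = [] , a , z , refl , refl
odd-cut (suc q) (a ∷ [])     t z        le eq = case trans le (cong (suc ∘ suc) (+-suc q q)) of λ ()
odd-cut (suc q) (a ∷ b ∷ r) t (c ∷ z) le eq with ++-split (a ∷ b ∷ []) (Θ c) eq (length-Θ c)
  where
  length-Θ : ∀ c → 2 ≡ length (Θ c)
  length-Θ false = refl
  length-Θ true  = refl
... | ab≡ , eq′ with odd-cut q r t z (suc-injective (suc-injective (trans le (cong (suc ∘ suc) (+-suc q q))))) eq′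
... | z₁ , d , z₂ , refl , t≡ = c ∷ z₁ , d , z₂ ,
      trans (cong (_++ ΘW z₁ ++ [ d ]) ab≡) (sym (++-assoc (Θ c) (ΘW z₁) [ d ])) , t≡

-- The left coding makes the letters at 2i and 2i + 1 differ, the right coding those at 2i + 1 and
-- 2i + 2; so the word alternates.
Θ-overlap : ∀ a z₁ z₂ → ΘW z₁ ++ [ a ] ≡ a ∷ ΘW z₂ →
            ΘW z₁ ++ [ a ] ≡ (a ∷ not a ∷ []) ^ʷ length z₁ ++ [ a ]
Θ-overlap a []       z₂ eq = refl
Θ-overlap a (b ∷ z₁) z₂ eq with a | b | z₂
... | false | false | true ∷ z₃ = cong (λ w → false ∷ true ∷ w)
      (Θ-overlap false z₁ z₃ (∷-injectiveʳ (∷-injectiveʳ eq)))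
... | true | true | false ∷ z₃ = cong (λ w → true ∷ false ∷ w)
      (Θ-overlap true z₁ z₃ (∷-injectiveʳ (∷-injectiveʳ eq)))
... | false | false | [] = case eq of λ ()
... | false | false | false ∷ z₃ = case eq of λ ()
... | true | true | [] = case eq of λ ()
... | true | true | true ∷ z₃ = case eq of λ ()
... | false | true | z₃ = case eq of λ ()
... | true | false | z₃ = case eq of λ ()

ΘW-bar : ∀ z → ΘW (bar z) ≡ bar (ΘW z)
ΘW-bar []          = refl
ΘW-bar (false ∷ z) = cong (λ w → true ∷ false ∷ w) (ΘW-bar z)
ΘW-bar (true ∷ z)  = cong (λ w → false ∷ true ∷ w) (ΘW-bar z)

parity : ∀ n → ∃ λ q → n ≡ q + q ⊎ n ≡ suc (q + q)
parity zero = 0 , inj₁ refl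
parity (suc n) with parity n
... | q , inj₁ refl = q , inj₂ refl
... | q , inj₂ refl = suc q , inj₁ (cong suc (sym (+-suc q q)))

-- P is the set of prefixes of an infinite word fixed by f and by f ′.
module Marked
  (f : Morphism) (ρ : Word → Word) (ρ-anti : Anti ρ)
  (ρ-bar : ∀ w → ρ (bar w) ≡ bar (ρ w)) (ρ-length : ∀ w → length (ρ w) ≡ length w)
  (P : Word → Set) (P-prefix : ∀ {v w} → v ≼ w → P w → P v)
  (P-comparable : ∀ {v w} → P v → P w → Comparable v w)
  (P-f : ∀ {v} → P v → P (img f v)) (P-f′ : ∀ {v} → P v → P (img (f ′) v))
  (P-0 : P [ false ])
  (f-0 : Starts false (f false)) (f-1 : Starts true (f true))
  (ρ-f : ∀ b → ρ (f b) ≡ f b)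
  (shorter : length (f true) < length (f false))
  (mixed : ¬ (All (_≡ false) (f false) × All (_≡ true) (f true)))
  (aperiodic : ¬ (∀ n → ∃ λ m → n ≤ m × P ((false ∷ true ∷ []) ^ʷ m)))
  where

  X Y X̄ Ȳ : Word
  X = f false
  Y = f true
  X̄ = bar X
  Ȳ = bar Y

  P-X : P X
  P-X = subst P (img-letter f false) (P-f P-0)

  P-Ȳ : P Ȳ
  P-Ȳ = subst P (img-letter (f ′) false) (P-f′ P-0)

  Ȳ-0 : Starts false Ȳ
  Ȳ-0 = starts-bar f-1

  X̄-1 : Starts true X̄
  X̄-1 = starts-bar f-0

  Ȳ≼X : Ȳ ≼ X
  Ȳ≼X = comparable-length (P-comparable P-Ȳ P-X) (≤-trans (≤-reflexive (length-bar Y)) (<⇒≤ shorter))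

  T : Word
  T = proj₁ Ȳ≼X

  X≡ȲT : X ≡ Ȳ ++ T
  X≡ȲT = sym (proj₂ Ȳ≼X)

  ρ-Ȳ : ρ Ȳ ≡ Ȳ
  ρ-Ȳ = trans (ρ-bar Y) (cong bar (ρ-f true))

  ρ-Ȳ^ : ∀ j → ρ (Ȳ ^ʷ j) ≡ Ȳ ^ʷ j
  ρ-Ȳ^ j = trans (anti-^ʷ ρ ρ-anti Ȳ j) (cong (_^ʷ j) ρ-Ȳ)

  T≢[] : T ≢ []
  T≢[] T≡[] = <⇒≢ shorter (trans (sym (length-bar Y))
    (cong length (sym (trans X≡ȲT (trans (cong (Ȳ ++_) T≡[]) (++-identityʳ Ȳ))))))

  Y≢[] : Y ≢ []
  Y≢[] Y≡[] with trans (sym Y≡[]) (proj₂ f-1)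
  ... | ()

  -- If X had only zeros, so would its prefix Ȳ, and Y would have only ones, which `mixed` excludes.
  run : ∃₂ λ j w → X ≡ [ false ] ^ʷ j ++ true ∷ w
  run with zeros-or-one X
  ... | inj₂ r  = r
  ... | inj₁ zs = ⊥-elim (mixed (zs , subst (All (_≡ true)) (bar-involutive Y)
        (All.map⁺ (All.map (cong not) (All.++⁻ˡ Ȳ (subst (All (_≡ false)) X≡ȲT zs))))))

  -- As 0ʲ1 is a prefix of the infinite word, so are its images XʲY under `f` and ȲʲX̄ under `f ′`.
  -- Comparing them excludes j ≥ 2.
  module _ (j : ℕ) (0ʲ1≼X : [ false ] ^ʷ j ++ [ true ] ≼ X) where

    P-0ʲ1 : P ([ false ] ^ʷ j ++ [ true ])
    P-0ʲ1 = P-prefix 0ʲ1≼X P-X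

    img-0ʲ1 : ∀ g → img g ([ false ] ^ʷ j ++ [ true ]) ≡ g false ^ʷ j ++ g true
    img-0ʲ1 g = trans (img-++ g ([ false ] ^ʷ j) [ true ])
      (cong₂ _++_ (trans (img-^ʷ g [ false ] j) (cong (_^ʷ j) (img-letter g false))) (img-letter g true))

    P-XʲY : P (X ^ʷ j ++ Y)
    P-XʲY = subst P (img-0ʲ1 f) (P-f P-0ʲ1)

    P-ȲʲX̄ : P (Ȳ ^ʷ j ++ X̄)
    P-ȲʲX̄ = subst P (img-0ʲ1 (f ′)) (P-f′ P-0ʲ1)

    P-Ȳ^ : ∀ i → i ≤ j → P (Ȳ ^ʷ i)
    P-Ȳ^ i i≤j = P-prefix (≼-trans
      (Ȳ ^ʷ (j ∸ i) , trans (sym (^ʷ-+ Ȳ i (j ∸ i))) (cong (Ȳ ^ʷ_) (m+[n∸m]≡n i≤j))) (≼-++ (Ȳ ^ʷ j))) P-ȲʲX̄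

    -- Division of X by Ȳ with remainder, stopped at the quotient j because only Ȳʲ is known to
    -- begin the infinite word.
    divide : ∀ i → i ≤ j → (∃ λ p → X ≡ Ȳ ^ʷ i ++ p) ⊎
             (∃₂ λ i′ g → i′ < i × length g < length Y × X ≡ Ȳ ^ʷ i′ ++ g)
    divide zero    _   = inj₁ (X , refl)
    divide (suc i) i<j with divide i (<⇒≤ i<j)
    ... | inj₂ (i′ , g , i′<i , rest) = inj₂ (i′ , g , m<n⇒m<1+n i′<i , rest)
    ... | inj₁ (p , X≡) with length p <? length Y
    ... | yes p<Y = inj₂ (i , p , ≤-refl , p<Y , X≡)
    ... | no  p≮Y with comparable-length
            (comparable-++ (Ȳ ^ʷ i) (subst₂ Comparable (sym (^ʷ-comm Ȳ i)) X≡ (P-comparable (P-Ȳ^ (suc i) i<j) P-X)))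
            (subst (_≤ length p) (sym (length-bar Y)) (≮⇒≥ p≮Y))
    ... | q , refl = inj₁ (q , trans X≡ (trans (sym (++-assoc (Ȳ ^ʷ i) Ȳ q)) (cong (_++ q) (^ʷ-comm Ȳ i))))

    P-XX : 2 ≤ j → P (X ++ X)
    P-XX (s≤s (s≤s {n = i} z≤n)) = P-prefix
      (X ^ʷ i ++ Y , trans (++-assoc X X (X ^ʷ i ++ Y)) (sym (trans (++-assoc X (X ^ʷ suc i) Y) (cong (X ++_) (++-assoc X (X ^ʷ i) Y))))) P-XʲY

    Y^-1 : ∀ {i} → 1 ≤ i → Starts true (Y ^ʷ i)
    Y^-1 (s≤s {n = i} _) = starts-++ f-1 (Y ^ʷ i)

    -- If X = Ȳʲp then X̄ = pYʲ, and XX and ȲʲX̄ disagree after their common prefix Ȳʲp.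
    no-full-quotient : 2 ≤ j → ∀ p → X ≢ Ȳ ^ʷ j ++ p
    no-full-quotient 2≤j p X≡ = starts-clash f-0 (Y^-1 (<⇒≤ 2≤j)) clash
      where
      X≡ρpȲʲ : X ≡ ρ p ++ Ȳ ^ʷ j
      X≡ρpȲʲ = trans (sym (ρ-f false)) (trans (cong ρ X≡) (trans (ρ-anti (Ȳ ^ʷ j) p) (cong (ρ p ++_) (ρ-Ȳ^ j))))
      X̄≡ : X̄ ≡ bar (ρ p) ++ Y ^ʷ j
      X̄≡ = trans (cong bar X≡ρpȲʲ) (trans (bar-++ (ρ p) (Ȳ ^ʷ j))
        (cong (bar (ρ p) ++_) (trans (bar-^ʷ Ȳ j) (cong (_^ʷ j) (bar-involutive Y)))))
      -- X = Ȳʲp and ȲʲX̄ are both prefixes, so p begins X̄; `bar (ρ p)` begins it too and has the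
      -- same length.
      p≼X̄ : p ≼ X̄
      p≼X̄ = comparable-length (comparable-++ (Ȳ ^ʷ j) (subst (λ w → Comparable w _) X≡ (P-comparable P-X P-ȲʲX̄)))
        (≤-trans (length-++-≤ʳ p {Ȳ ^ʷ j}) (≤-reflexive (trans (cong length (sym X≡)) (sym (length-bar X)))))
      X̄≡pYʲ : X̄ ≡ p ++ Y ^ʷ j
      X̄≡pYʲ with ++-split (bar (ρ p)) p (trans (sym X̄≡) (sym (proj₂ p≼X̄))) (trans (length-bar (ρ p)) (ρ-length p))
      ... | e , _ = trans X̄≡ (cong (_++ Y ^ʷ j) e)
      clash : Comparable X (Y ^ʷ j)
      clash = comparable-++ p (comparable-++ (Ȳ ^ʷ j) (subst₂ Comparable
        (trans (cong (_++ X) X≡) (++-assoc (Ȳ ^ʷ j) p X))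
        (cong (Ȳ ^ʷ j ++_) X̄≡pYʲ)
        (P-comparable (P-XX 2≤j) P-ȲʲX̄)))

    -- If X = Ȳⁱg with 1 ≤ i < j and |g| < |Y| then Ȳ and g commute, hence so do X and Ȳ.
    no-partial-quotient : ∀ i g → suc i < j → length g < length Y → X ≢ Ȳ ^ʷ suc i ++ g
    no-partial-quotient i g i<j g<Y X≡ = starts-clash X-0 X̄-1 clash
      where
      2≤j : 2 ≤ j
      2≤j = ≤-trans (s≤s (s≤s z≤n)) i<j
      g<Ȳ : length g < length Ȳ
      g<Ȳ = subst (length g <_) (sym (length-bar Y)) g<Y
      -- XX and a power of Ȳ are both prefixes; after the full powers of Ȳ in X they continue with
      -- gX and Ȳ, and Ȳ begins X.
      Ȳ≼gȲ : Ȳ ≼ g ++ Ȳ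
      Ȳ≼gȲ = comparable-length
        (comparable-sym (comparable-≼ (++-mono-≼ g Ȳ≼X)
          (comparable-++ (Ȳ ^ʷ suc i) (subst₂ Comparable
            (trans (cong (_++ X) X≡) (++-assoc (Ȳ ^ʷ suc i) g X)) (sym (^ʷ-comm Ȳ (suc i)))
            (P-comparable (P-XX 2≤j) (P-Ȳ^ (suc (suc i)) i<j))))))
        (length-++-≤ʳ Ȳ {g})
      g≼Ȳ : g ≼ Ȳ
      g≼Ȳ = comparable-length (prefixes-comparable Ȳ≼gȲ (≼-++ g)) (<⇒≤ g<Ȳ)
      ρg≡g : ρ g ≡ g
      ρg≡g = comparable-≡ (prefixes-comparable (≼-trans g≼Ȳ Ȳ≼X) (Ȳ ^ʷ suc i ,
        trans (cong (ρ g ++_) (sym (ρ-Ȳ^ (suc i)))) (trans (sym (ρ-anti (Ȳ ^ʷ suc i) g)) (trans (cong ρ (sym X≡)) (ρ-f false)))))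
        (ρ-length g)
      h : Word
      h = proj₁ Ȳ≼gȲ
      z : Word
      z = proj₁ g≼Ȳ
      Ȳ≡ρzg : Ȳ ≡ ρ z ++ g
      Ȳ≡ρzg = trans (sym ρ-Ȳ) (trans (cong ρ (sym (proj₂ g≼Ȳ))) (trans (ρ-anti g z) (cong (ρ z ++_) ρg≡g)))
      |h|≡|g| : length h ≡ length g
      |h|≡|g| = +-cancelˡ-≡ (length Ȳ) _ _ (trans (sym (length-++ Ȳ)) (trans (cong length (proj₂ Ȳ≼gȲ))
        (trans (length-++ g) (+-comm (length g) (length Ȳ)))))
      -- By the symmetry ρ the word Ȳ also ends in g, so in Ȳh = gȲ the last |g| letters h are g.
      gȲ≡Ȳg : g ++ Ȳ ≡ Ȳ ++ g
      gȲ≡Ȳg = trans (sym (proj₂ Ȳ≼gȲ)) (cong (Ȳ ++_)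
        (proj₂ (++-splitʳ Ȳ (g ++ ρ z) (trans (proj₂ Ȳ≼gȲ) (trans (cong (g ++_) Ȳ≡ρzg) (sym (++-assoc g (ρ z) g)))) |h|≡|g|)))
      T≡ : T ≡ Ȳ ^ʷ i ++ g
      T≡ = ++-cancelˡ Ȳ _ _ (trans (sym X≡ȲT) (trans X≡ (++-assoc Ȳ (Ȳ ^ʷ i) g)))
      ȲT≡TȲ : Ȳ ++ T ≡ T ++ Ȳ
      ȲT≡TȲ = begin
        Ȳ ++ T             ≡⟨ cong (Ȳ ++_) T≡ ⟩
        Ȳ ++ Ȳ ^ʷ i ++ g   ≡⟨ sym (++-assoc Ȳ (Ȳ ^ʷ i) g) ⟩
        Ȳ ^ʷ suc i ++ g    ≡⟨ cong (_++ g) (sym (^ʷ-comm Ȳ i)) ⟩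
        (Ȳ ^ʷ i ++ Ȳ) ++ g ≡⟨ ++-assoc (Ȳ ^ʷ i) Ȳ g ⟩
        Ȳ ^ʷ i ++ Ȳ ++ g   ≡⟨ cong (Ȳ ^ʷ i ++_) (sym gȲ≡Ȳg) ⟩
        Ȳ ^ʷ i ++ g ++ Ȳ   ≡⟨ sym (++-assoc (Ȳ ^ʷ i) g Ȳ) ⟩
        (Ȳ ^ʷ i ++ g) ++ Ȳ ≡⟨ cong (_++ Ȳ) (sym T≡) ⟩
        T ++ Ȳ             ∎
        where open ≡-Reasoning
      T-0 : Starts false T
      T-0 = starts-++⁻ T≢[] (subst (Starts false) (trans X≡ȲT ȲT≡TȲ) f-0)
      T^-0 : ∀ {i} → 1 ≤ i → Starts false (T ^ʷ i)
      T^-0 (s≤s {n = i} _) = starts-++ T-0 (T ^ʷ i)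
      X-0 : Starts false (T ^ʷ j ++ Y)
      X-0 = starts-++ (T^-0 (<⇒≤ 2≤j)) Y
      -- Since Ȳ and T commute, XʲY = ȲʲTʲY; after Ȳʲ it reads 0 where ȲʲX̄ reads 1.
      clash : Comparable (T ^ʷ j ++ Y) X̄
      clash = comparable-++ (Ȳ ^ʷ j) (subst (λ w → Comparable w (Ȳ ^ʷ j ++ X̄))
        (trans (cong (_++ Y) (trans (cong (_^ʷ j) X≡ȲT) (^ʷ-distrib Ȳ T ȲT≡TȲ j))) (++-assoc (Ȳ ^ʷ j) (T ^ʷ j) Y))
        (P-comparable P-XʲY P-ȲʲX̄))

    j≱2 : ¬ 2 ≤ j
    j≱2 2≤j with divide j ≤-refl
    ... | inj₁ (p , X≡) = no-full-quotient 2≤j p X≡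
    ... | inj₂ (zero , g , _ , g<Y , X≡) = <-asym (subst (λ w → length w < length Y) (sym X≡) g<Y) shorter
    ... | inj₂ (suc i , g , i<j , g<Y , X≡) = no-partial-quotient i g i<j g<Y X≡

  01≼X : false ∷ true ∷ [] ≼ X
  01≼X with run
  ... | zero , w , X≡ with trans (sym X≡) (proj₂ f-0)
  ...   | ()
  01≼X | suc zero , w , X≡ = w , sym X≡
  01≼X | suc (suc j) , w , X≡ = ⊥-elim (j≱2 (suc (suc j)) (w ,
    trans (++-assoc ([ false ] ^ʷ suc (suc j)) [ true ] w) (sym X≡)) (s≤s (s≤s z≤n)))

  -- The two sides are the images of the prefix 01 under `f` and `f ′`, so they are comparable, and
  -- they have equal length.
  XY≡ȲX̄ : X ++ Y ≡ Ȳ ++ X̄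
  XY≡ȲX̄ = comparable-≡
    (subst₂ (λ u v → Comparable (u ++ Y) (v ++ X̄)) (++-identityʳ X) (++-identityʳ Ȳ)
      (P-comparable (P-XʲY 1 01≼X) (P-ȲʲX̄ 1 01≼X)))
    (trans (length-++ X) (trans (+-comm (length X) (length Y))
      (trans (cong₂ _+_ (sym (length-bar Y)) (sym (length-bar X))) (sym (length-++ Ȳ)))))

  YX≡X̄Ȳ : Y ++ X ≡ X̄ ++ Ȳ
  YX≡X̄Ȳ = bar-injective (trans (bar-++ Y X) (trans (sym XY≡ȲX̄)
    (sym (trans (bar-++ X̄ Ȳ) (cong₂ _++_ (bar-involutive X) (bar-involutive Y))))))

  X̄≡YT̄ : X̄ ≡ Y ++ bar T
  X̄≡YT̄ = trans (cong bar X≡ȲT) (trans (bar-++ Ȳ T) (cong (_++ bar T) (bar-involutive Y)))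

  -- With `X̄≡YT̄` this gives TY = YT̄, the equation solved by `conjugate-of-bar`.
  TY≡X̄ : T ++ Y ≡ X̄
  TY≡X̄ = ++-cancelˡ Ȳ _ _ (trans (sym (++-assoc Ȳ T Y)) (trans (cong (_++ Y) (sym X≡ȲT)) XY≡ȲX̄))

  T-1 : Starts true T
  T-1 = starts-++⁻ T≢[] (subst (Starts true) (sym TY≡X̄) X̄-1)

  -- T = (vv̄)ᵐ⁺¹, Y = (vv̄)ʰv and X = ȲT give the form with r = v̄. The exponent in X is a
  -- successor because T is nonempty; this keeps rr̄ a prefix of X, which is used to exclude odd
  -- |r|.
  factorisation : ∃ λ r → ∃₂ λ k h → r ≢ [] × X ≡ r ++ (bar r ++ r) ^ʷ suc k × Y ≡ (bar r ++ r) ^ʷ h ++ bar r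
  factorisation with conjugate-of-bar _ T Y ≤-refl T≢[] Y≢[] (trans TY≡X̄ X̄≡YT̄)
  ... | v , m , h , T≡ , Y≡ = bar v , h + m , h , r≢[] , X≡ ,
        trans Y≡ (cong (λ w → (w ++ bar v) ^ʷ h ++ w) (sym (bar-involutive v)))
    where
    r≢[] : bar v ≢ []
    r≢[] e = T≢[] (trans T≡ (trans (cong (λ w → (w ++ bar v) ^ʷ suc m) (bar-injective e))
      (trans (cong (_^ʷ suc m) e) ([]-^ʷ (suc m)))))
      where
      []-^ʷ : ∀ n → [] ^ʷ n ≡ []
      []-^ʷ zero    = refl
      []-^ʷ (suc n) = []-^ʷ n
    X≡ : X ≡ bar v ++ (bar (bar v) ++ bar v) ^ʷ suc (h + m)
    X≡ = begin
      X                                                             ≡⟨ X≡ȲT ⟩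
      bar Y ++ T                                                    ≡⟨ cong₂ (λ y t → bar y ++ t) Y≡ T≡ ⟩
      bar ((v ++ bar v) ^ʷ h ++ v) ++ (v ++ bar v) ^ʷ suc m         ≡⟨ cong (_++ (v ++ bar v) ^ʷ suc m)
        (trans (cong bar (^ʷ-slide v (bar v) h)) (trans (bar-++ v _) (cong (bar v ++_)
          (trans (bar-^ʷ _ h) (cong (_^ʷ h) (bar-++ (bar v) v)))))) ⟩
      (bar v ++ (bar (bar v) ++ bar v) ^ʷ h) ++ (v ++ bar v) ^ʷ suc m ≡⟨ ++-assoc (bar v) _ _ ⟩
      bar v ++ (bar (bar v) ++ bar v) ^ʷ h ++ (v ++ bar v) ^ʷ suc m ≡⟨ cong (λ w → bar v ++ (bar (bar v) ++ bar v) ^ʷ h ++ (w ++ bar v) ^ʷ suc m) (sym (bar-involutive v)) ⟩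
      bar v ++ (bar (bar v) ++ bar v) ^ʷ h ++ (bar (bar v) ++ bar v) ^ʷ suc m ≡⟨ cong (bar v ++_) (sym (^ʷ-+ _ h (suc m))) ⟩
      bar v ++ (bar (bar v) ++ bar v) ^ʷ (h + suc m)                ≡⟨ cong (λ n → bar v ++ (bar (bar v) ++ bar v) ^ʷ n) (+-suc h m) ⟩
      bar v ++ (bar (bar v) ++ bar v) ^ʷ suc (h + m)                ∎
      where open ≡-Reasoning

  f-Θ : ∀ z → img f (ΘW z) ≡ img (f ′) (ΘW z)
  f-Θ z = trans (img-∘ f Θ z) (trans (img-cong letter z) (sym (img-∘ (f ′) Θ z)))
    where
    letter : ∀ b → img f (Θ b) ≡ img (f ′) (Θ b)
    letter false = trans (img-pair f false true) (trans XY≡ȲX̄ (sym (img-pair (f ′) false true)))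
    letter true  = trans (img-pair f true false) (trans YX≡X̄Ȳ (sym (img-pair (f ′) true false)))

  -- A pair aa after an even prefix is impossible, since f(aa) and f′(aa) are incomparable.
  even-prefix : ∀ n w → length w ≡ n + n → P w → ∃ λ z → w ≡ ΘW z
  even-prefix zero    []      _  _  = [] , refl
  even-prefix (suc n) w       le pw
    with splitAtʷ (n + n) w (≤-trans (m≤n+m (n + n) 2) (≤-reflexive (sym (trans le (cong suc (+-suc n n))))))
  ... | w′ , t , refl , |w′| with t | +-cancelˡ-≡ (n + n) (length t) 2
          (trans (cong (_+ length t) (sym |w′|)) (trans (sym (length-++ w′)) (trans le (trans (cong suc (+-suc n n)) (+-comm 2 (n + n))))))
  ... | a ∷ b ∷ [] | _ with even-prefix n w′ |w′| (P-prefix (≼-++ w′) pw)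
  ... | z , refl = extend a b pw
    where
    cmp : ∀ a b → P (ΘW z ++ a ∷ b ∷ []) → Comparable (f a ++ f b) ((f ′) a ++ (f ′) b)
    cmp a b p = subst₂ Comparable (img-pair f a b) (img-pair (f ′) a b)
      (comparable-++ (img f (ΘW z)) (subst₂ Comparable (img-++ f (ΘW z) (a ∷ b ∷ []))
        (trans (img-++ (f ′) (ΘW z) (a ∷ b ∷ [])) (cong (_++ img (f ′) (a ∷ b ∷ [])) (sym (f-Θ z))))
        (P-comparable (P-f p) (P-f′ p))))
    extend : ∀ a b → P (ΘW z ++ a ∷ b ∷ []) → ∃ λ z′ → ΘW z ++ a ∷ b ∷ [] ≡ ΘW z′
    extend false true  _ = z ++ [ false ] , sym (img-++ Θ z [ false ])
    extend true  false _ = z ++ [ true ] , sym (img-++ Θ z [ true ])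
    -- f(00) = ȲTX and f′(00) = ȲȲ differ right after Ȳ, where T begins with 1; f(11) and f′(11)
    -- differ likewise after Y.
    extend false false p = ⊥-elim (starts-clash (starts-++ T-1 X) Ȳ-0
      (comparable-++ Ȳ (subst (λ w → Comparable w (Ȳ ++ Ȳ)) (trans (cong (_++ X) X≡ȲT) (++-assoc Ȳ T X)) (cmp false false p))))
    extend true true p = ⊥-elim (starts-clash f-1 (starts-++ (starts-bar T-1) X̄)
      (comparable-++ Y (subst (Comparable (Y ++ Y)) (trans (cong (_++ X̄) X̄≡YT̄) (++-assoc Y (bar T) X̄)) (cmp true true p))))

  -- A prefix r of even length is some Θ(w). If |r| were odd, rr̄ would still be a Θ-image; cut in
  -- the middle it forces r = 0101...0, so f(01) is a power of 01 and the infinite word is 0101....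
  conclusion : ∃ λ w → ∃₂ λ k h → w ≢ [] × ρ (ΘW w) ≡ ΘW w ×
    f false ≡ ΘW (w ++ (bar w ++ w) ^ʷ k) × f true ≡ ΘW ((bar w ++ w) ^ʷ h ++ bar w)
  conclusion with factorisation
  ... | r , k , h , r≢[] , X≡ , Y≡ with parity (length r)
  ... | q , inj₁ even with even-prefix q r even (P-prefix (_ , sym X≡) P-X)
  ... | w , refl = w , suc k , h , (λ { refl → r≢[] refl }) , ρr , 
        trans X≡ (trans (cong (ΘW w ++_) (Θ^ (suc k))) (sym (img-++ Θ w _))) ,
        trans Y≡ (trans (cong₂ _++_ (Θ^ h) (sym (ΘW-bar w))) (sym (img-++ Θ ((bar w ++ w) ^ʷ h) (bar w))))
    where
    r′ = ΘW w
    Θ^ : ∀ n → (bar (ΘW w) ++ ΘW w) ^ʷ n ≡ ΘW ((bar w ++ w) ^ʷ n)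
    Θ^ n = trans (cong (_^ʷ n) (trans (cong (_++ ΘW w) (sym (ΘW-bar w))) (sym (img-++ Θ (bar w) w)))) (sym (img-^ʷ Θ (bar w ++ w) n))
    -- X = (rr̄)ᵏ⁺¹r ends in r, so ρ(r) begins ρ(X) = X, as r does.
    ρr : ρ r′ ≡ r′
    ρr = proj₁ (++-split (ρ r′) r′
      (trans (sym (ρ-anti _ r′)) (trans (cong ρ (trans (^ʷ-slide r′ (bar r′) (suc k)) (sym X≡)))
        (trans (ρ-f false) X≡))) (ρ-length r′))
  conclusion | r , k , h , r≢[] , X≡ , Y≡ | q , inj₂ odd
    with even-prefix (length r) (r ++ bar r) (trans (length-++ r) (cong (length r +_) (length-bar r)))
      (P-prefix (r ++ (bar r ++ r) ^ʷ k , trans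
        (trans (++-assoc r (bar r) _) (cong (r ++_) (sym (++-assoc (bar r) r _)))) (sym X≡)) P-X)
  ... | z , rr̄≡ with odd-cut q r (bar r) z odd rr̄≡
  ... | z₁ , a , z₂ , refl , r̄≡ = ⊥-elim (aperiodic alternating)
    where
    r′ = ΘW z₁ ++ [ a ]
    r″ : r′ ≡ a ∷ ΘW (bar z₂)
    r″ = trans (sym (bar-involutive r′)) (trans (cong bar r̄≡) (cong₂ _∷_ (not-involutive a) (sym (ΘW-bar z₂))))
    a≡0 : a ≡ false
    a≡0 = starts-a (subst (Starts false) X≡ f-0)
      where
      starts-a : Starts false (r′ ++ (bar r′ ++ r′) ^ʷ suc k) → a ≡ false
      starts-a s with subst (λ w → Starts false (w ++ (bar r′ ++ r′) ^ʷ suc k)) r″ s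
      ... | _ , refl = refl
    01ʷ : Word
    01ʷ = false ∷ true ∷ []
    l : ℕ
    l = length z₁
    r≡ : r′ ≡ 01ʷ ^ʷ l ++ [ false ]
    r≡ = subst (λ b → r′ ≡ (b ∷ not b ∷ []) ^ʷ l ++ [ b ]) a≡0 (Θ-overlap a z₁ (bar z₂) r″)
    rr̄ : r′ ++ bar r′ ≡ 01ʷ ^ʷ suc (l + l)
    rr̄ = begin
      r′ ++ bar r′                                       ≡⟨ cong (λ w → w ++ bar w) r≡ ⟩
      (01ʷ ^ʷ l ++ [ false ]) ++ bar (01ʷ ^ʷ l ++ [ false ]) ≡⟨ cong (λ w → (01ʷ ^ʷ l ++ [ false ]) ++ w)
           (trans (bar-++ (01ʷ ^ʷ l) [ false ]) (cong (_++ [ true ]) (bar-^ʷ 01ʷ l))) ⟩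
      (01ʷ ^ʷ l ++ [ false ]) ++ 10ʷ ^ʷ l ++ [ true ]    ≡⟨ ++-assoc (01ʷ ^ʷ l) [ false ] _ ⟩
      01ʷ ^ʷ l ++ [ false ] ++ 10ʷ ^ʷ l ++ [ true ]      ≡⟨ cong (λ w → 01ʷ ^ʷ l ++ [ false ] ++ w) (^ʷ-slide [ true ] [ false ] l) ⟩
      01ʷ ^ʷ l ++ 01ʷ ++ 01ʷ ^ʷ l                        ≡⟨ sym (^ʷ-+ 01ʷ l (suc l)) ⟩
      01ʷ ^ʷ (l + suc l)                                 ≡⟨ cong (01ʷ ^ʷ_) (+-suc l l) ⟩
      01ʷ ^ʷ suc (l + l)                                 ∎
      where
      open ≡-Reasoning
      10ʷ : Word
      10ʷ = true ∷ false ∷ []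
    -- XY = (rr̄)ᵏ⁺ʰ⁺² and rr̄ = (01)²ˡ⁺¹. That `N` is at least 2 makes the prefixes (01)ᵐ grow
    -- under `f`.
    N : ℕ
    N = (suc k + suc h) * suc (l + l)
    f01 : img f 01ʷ ≡ 01ʷ ^ʷ N
    f01 = begin
      img f 01ʷ                                          ≡⟨ img-pair f false true ⟩
      X ++ Y                                             ≡⟨ cong₂ _++_ X≡ Y≡ ⟩
      (r′ ++ (bar r′ ++ r′) ^ʷ suc k) ++ (bar r′ ++ r′) ^ʷ h ++ bar r′
         ≡⟨ cong₂ _++_ (sym (^ʷ-slide r′ (bar r′) (suc k))) (^ʷ-slide (bar r′) r′ h) ⟩
      ((r′ ++ bar r′) ^ʷ suc k ++ r′) ++ bar r′ ++ (r′ ++ bar r′) ^ʷ h ≡⟨ ++-assoc ((r′ ++ bar r′) ^ʷ suc k) r′ _ ⟩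
      (r′ ++ bar r′) ^ʷ suc k ++ r′ ++ bar r′ ++ (r′ ++ bar r′) ^ʷ h
         ≡⟨ cong ((r′ ++ bar r′) ^ʷ suc k ++_) (sym (++-assoc r′ (bar r′) _)) ⟩
      (r′ ++ bar r′) ^ʷ suc k ++ (r′ ++ bar r′) ^ʷ suc h ≡⟨ sym (^ʷ-+ (r′ ++ bar r′) (suc k) (suc h)) ⟩
      (r′ ++ bar r′) ^ʷ (suc k + suc h)                  ≡⟨ cong (_^ʷ (suc k + suc h)) rr̄ ⟩
      (01ʷ ^ʷ suc (l + l)) ^ʷ (suc k + suc h)            ≡⟨ sym (^ʷ-* 01ʷ (suc (l + l)) (suc k + suc h)) ⟩
      01ʷ ^ʷ N                                           ∎
      where open ≡-Reasoning
    2≤N : 2 ≤ N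
    2≤N = ≤-trans (s≤s (≤-trans (s≤s z≤n) (m≤n+m (suc h) k))) (m≤m*n (suc k + suc h) (suc (l + l)))
    alternating : ∀ n → ∃ λ m → n ≤ m × P (01ʷ ^ʷ m)
    alternating n with go n
      where
      go : ∀ n → ∃ λ m → n < m × P (01ʷ ^ʷ m)
      go zero    = 1 , ≤-refl , P-prefix 01≼X P-X
      go (suc n) with go n
      ... | m , n<m , p = m * N , ≤-trans (s≤s n<m) (≤-trans (+-monoˡ-≤ m (≤-trans (s≤s z≤n) n<m))
              (≤-trans (≤-reflexive (trans (cong (m +_) (sym (+-identityʳ m))) (*-comm 2 m))) (*-monoʳ-≤ m 2≤N))) ,
              subst P (trans (img-^ʷ f 01ʷ m) (trans (cong (_^ʷ m) f01) (sym (^ʷ-* 01ʷ N m)))) (P-f p)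
    ... | m , n<m , p = m , <⇒≤ n<m , p

-- Branching of binary morphisms, and counting words

-- `p` is the longest common prefix of χ(0z) and χ(1z′) for long z and z′, and `a` is the letter
-- following it in χ(0z). The image of a short z may end before this point, whence the threshold
-- `N`.
LCP : Morphism → Set
LCP χ = ∃ λ p → ∃₂ λ a N → ∀ z → N ≤ length z →
        p ++ [ a ] ≼ img χ (false ∷ z) × p ++ [ not a ] ≼ img χ (true ∷ z)

branch : ∀ x y → x ≼ y ⊎ y ≼ x ⊎ (∃₂ λ p a → p ++ [ a ] ≼ x × p ++ [ not a ] ≼ y)
branch []      y  = inj₁ (y , refl)
branch (a ∷ x) [] = inj₂ (inj₁ (a ∷ x , refl))
branch (a ∷ x) (b ∷ y) with a Bool.≟ b
... | no a≢b rewrite ≢⇒≡not a≢b = inj₂ (inj₂ ([] , a , (x , refl) , (y , refl)))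
... | yes refl with branch x y
... | inj₁ (t , refl) = inj₁ (t , refl)
... | inj₂ (inj₁ (t , refl)) = inj₂ (inj₁ (t , refl))
... | inj₂ (inj₂ (p , b , (s , refl) , (t , refl))) = inj₂ (inj₂ (a ∷ p , b , (s , refl) , (t , refl)))

NonCommuting : Morphism → Set
NonCommuting χ = χ false ++ χ true ≢ χ true ++ χ false

-- If χ(0) = χ(1)z then χ = χ₁ ∘ τ with χ₁(0) = z, χ₁(1) = χ(1), τ(0) = 10, τ(1) = 1.
lcp-reduce : ∀ χ z → χ false ≡ χ true ++ z →
             LCP (λ b → if b then χ true else z) → LCP χ
lcp-reduce χ z eq (p , a , N , q) = χ true ++ p , a , suc N , λ w N<w → zero′ w (<⇒≤ N<w) , one w N<w
  where
  χ₁ τ : Morphism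
  χ₁ b = if b then χ true else z
  τ false = true ∷ false ∷ []
  τ true  = true ∷ []
  χ₁τ : ∀ w → img χ₁ (img τ w) ≡ img χ w
  χ₁τ w = trans (img-∘ χ₁ τ w) (img-cong letter w)
    where
    letter : ∀ b → img χ₁ (τ b) ≡ χ b
    letter false = trans (img-pair χ₁ true false) (sym eq)
    letter true  = ++-identityʳ (χ true)
  τ-length : ∀ w → length w ≤ length (img τ w)
  τ-length []          = z≤n
  τ-length (false ∷ w) = s≤s (m≤n⇒m≤1+n (τ-length w))
  τ-length (true ∷ w)  = s≤s (τ-length w)
  zero′ : ∀ w → N ≤ length w → (χ true ++ p) ++ [ a ] ≼ img χ (false ∷ w)
  zero′ w N≤w = subst₂ _≼_ (sym (++-assoc (χ true) p [ a ]))
    (trans (cong (λ x → χ true ++ z ++ x) (χ₁τ w)) (trans (sym (++-assoc (χ true) z _)) (cong (_++ img χ w) (sym eq))))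
    (++-mono-≼ (χ true) (proj₁ (q (img τ w) (≤-trans N≤w (τ-length w)))))
  one : ∀ w → N < length w → (χ true ++ p) ++ [ not a ] ≼ img χ (true ∷ w)
  one (c ∷ w) (s≤s N≤w) with tail c
    where
    tail : ∀ c → ∃ λ t → img τ (c ∷ w) ≡ true ∷ t × length w ≤ length t
    tail false = false ∷ img τ w , refl , m≤n⇒m≤1+n (τ-length w)
    tail true  = img τ w , refl , τ-length w
  ... | t , τ≡ , w≤t = subst₂ _≼_ (sym (++-assoc (χ true) p _))
    (cong (χ true ++_) (trans (cong (img χ₁) (sym τ≡)) (χ₁τ (c ∷ w))))
    (++-mono-≼ (χ true) (proj₂ (q t (≤-trans N≤w w≤t))))

lcp-swap : ∀ χ → LCP (χ ∘ not) → LCP χ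
lcp-swap χ (p , a , N , q) = p , not a , N , λ z N≤z →
  let r₀ , r₁ = q (bar z) (subst (N ≤_) (sym (length-bar z)) N≤z) in
  subst (λ w → p ++ [ not a ] ≼ χ false ++ w) (img-not z) r₁ ,
  subst₂ (λ b w → p ++ [ b ] ≼ χ true ++ w) (sym (not-involutive a)) (img-not z) r₀
  where
  img-not : ∀ z → img (χ ∘ not) (bar z) ≡ img χ z
  img-not z = trans (sym (img-bar χ (bar z))) (cong (img χ) (bar-involutive z))

abstract
  -- Euclid's algorithm on the two images: if one is a prefix of the other it is cancelled, which
  -- keeps them from commuting and lowers the total length; otherwise they already branch.
  lcp : ∀ n χ → length (χ false) + length (χ true) ≤ n → NonCommuting χ → LCP χ
  lcp-shrink : ∀ n χ z → length (χ false) + length (χ true) ≤ suc n → NonCommuting χ →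
               χ false ≡ χ true ++ z → LCP χ
  lcp zero χ le nc = ⊥-elim (nc (trans (cong₂ _++_ χ0 χ1) (sym (cong₂ _++_ χ1 χ0))))
    where
    empty : ∀ {w : Word} → length w ≤ 0 → w ≡ []
    empty {[]} _ = refl
    χ0 : χ false ≡ []
    χ0 = empty (≤-trans (m≤m+n _ _) le)
    χ1 : χ true ≡ []
    χ1 = empty (≤-trans (m≤n+m _ _) le)
  lcp (suc n) χ le nc with branch (χ false) (χ true)
  ... | inj₁ (z , eq) = lcp-swap χ (lcp-shrink n (χ ∘ not) z
          (subst (_≤ suc n) (+-comm (length (χ false)) (length (χ true))) le) (nc ∘ sym) (sym eq))
  ... | inj₂ (inj₁ (z , eq)) = lcp-shrink n χ z le nc (sym eq)
  ... | inj₂ (inj₂ (p , a , p₀ , p₁)) = p , a , 0 , λ z _ → ≼-trans p₀ (≼-++ (χ false) {img χ z}) , ≼-trans p₁ (≼-++ (χ true) {img χ z})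

  lcp-shrink n χ z le nc eq = lcp-reduce χ z eq (lcp n χ₁ smaller nc₁)
    where
    χ₁ : Morphism
    χ₁ b = if b then χ true else z
    y : Word
    y = χ true
    nc₁ : NonCommuting χ₁
    nc₁ zy≡yz = nc (trans (cong (_++ y) eq) (trans (++-assoc y z y) (trans (cong (y ++_) zy≡yz) (cong (y ++_) (sym eq)))))
    y≢[] : y ≢ []
    y≢[] y≡[] = nc (trans (cong (χ false ++_) y≡[]) (trans (++-identityʳ _) (sym (cong (_++ χ false) y≡[]))))
    smaller : length z + length y ≤ n
    smaller = s≤s⁻¹ (≤-trans (+-monoˡ-≤ (length y) (subst (λ w → length z < length w) (sym eq) (length-<-++ˡ y≢[] z))) le)

rev : Morphism → Morphism
rev χ b = reverse (χ b)

img-rev : ∀ χ w → img (rev χ) w ≡ reverse (img χ (reverse w))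
img-rev = img-anti reverse reverse-++

rev-noncommuting : ∀ χ → NonCommuting χ → NonCommuting (rev χ)
rev-noncommuting χ nc eq = nc (sym (reverse-injective
  (trans (reverse-++ (χ true) (χ false)) (trans eq (sym (reverse-++ (χ false) (χ true)))))))

sumW : ℕ → (Word → ℕ) → ℕ
sumW zero    f = f []
sumW (suc n) f = sumW n (f ∘ (false ∷_)) + sumW n (f ∘ (true ∷_))

sumW-mono : ∀ n {f g} → (∀ w → length w ≡ n → f w ≤ g w) → sumW n f ≤ sumW n g
sumW-mono zero    f≤g = f≤g [] refl
sumW-mono (suc n) f≤g = +-mono-≤ (sumW-mono n (λ w le → f≤g (false ∷ w) (cong suc le)))
                                 (sumW-mono n (λ w le → f≤g (true ∷ w) (cong suc le)))

sumW-+ : ∀ n f g → sumW n (λ w → f w + g w) ≡ sumW n f + sumW n g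
sumW-+ zero    f g = refl
sumW-+ (suc n) f g = trans (cong₂ _+_ (sumW-+ n _ _) (sumW-+ n _ _))
  (+-interchange (sumW n (f ∘ (false ∷_))) (sumW n (g ∘ (false ∷_))) _ _)
  where
  +-interchange : ∀ a b c d → (a + b) + (c + d) ≡ (a + c) + (b + d)
  +-interchange a b c d = trans (+-assoc a b (c + d)) (trans (cong (a +_) (trans (sym (+-assoc b c d))
    (trans (cong (_+ d) (+-comm b c)) (+-assoc c b d)))) (sym (+-assoc a c (b + d))))

sumW-0 : ∀ n → sumW n (λ _ → 0) ≡ 0
sumW-0 zero    = refl
sumW-0 (suc n) = cong₂ _+_ (sumW-0 n) (sumW-0 n)

δ : Word → Word → ℕ
δ []      []      = 1
δ []      (_ ∷ _) = 0
δ (_ ∷ _) []      = 0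
δ (a ∷ v) (b ∷ w) = if does (a Bool.≟ b) then δ v w else 0

δ-refl : ∀ v → δ v v ≡ 1
δ-refl []          = refl
δ-refl (false ∷ v) = δ-refl v
δ-refl (true ∷ v)  = δ-refl v

δ-≢ : ∀ v w → v ≢ w → δ v w ≡ 0
δ-≢ []      []      v≢w = ⊥-elim (v≢w refl)
δ-≢ []      (_ ∷ _) _   = refl
δ-≢ (_ ∷ _) []      _   = refl
δ-≢ (a ∷ v) (b ∷ w) v≢w with a Bool.≟ b
... | yes refl = δ-≢ v w (v≢w ∘ cong (a ∷_))
... | no _     = refl

sumW-δ : ∀ v → sumW (length v) (δ v) ≡ 1
sumW-δ []          = refl
sumW-δ (false ∷ v) = cong₂ _+_ (sumW-δ v) (sumW-0 (length v))
sumW-δ (true ∷ v)  = cong₂ _+_ (sumW-0 (length v)) (sumW-δ v)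

sumW-δ-≤ : ∀ n v → sumW n (δ v) ≤ 1
sumW-δ-≤ zero    []          = ≤-refl
sumW-δ-≤ zero    (_ ∷ _)     = z≤n
sumW-δ-≤ (suc n) []          = ≤-trans (≤-reflexive (cong₂ _+_ (sumW-0 n) (sumW-0 n))) z≤n
sumW-δ-≤ (suc n) (false ∷ v) = ≤-trans (≤-reflexive (trans (cong (sumW n (δ v) +_) (sumW-0 n)) (+-identityʳ _))) (sumW-δ-≤ n v)
sumW-δ-≤ (suc n) (true ∷ v)  = ≤-trans (≤-reflexive (cong (_+ sumW n (δ v)) (sumW-0 n))) (sumW-δ-≤ n v)

multiplicity : List Word → Word → ℕ
multiplicity []       w = 0
multiplicity (v ∷ vs) w = δ v w + multiplicity vs w

sumW-multiplicity : ∀ n vs → All (λ v → length v ≡ n) vs → sumW n (multiplicity vs) ≡ length vs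
sumW-multiplicity n []       []            = sumW-0 n
sumW-multiplicity _ (v ∷ vs) (refl ∷ lens) = trans (sumW-+ (length v) (δ v) (multiplicity vs))
  (cong₂ _+_ (sumW-δ v) (sumW-multiplicity (length v) vs lens))

sumW-multiplicity-≤ : ∀ n vs → sumW n (multiplicity vs) ≤ length vs
sumW-multiplicity-≤ n []       = ≤-reflexive (sumW-0 n)
sumW-multiplicity-≤ n (v ∷ vs) = ≤-trans (≤-reflexive (sumW-+ n (δ v) (multiplicity vs)))
  (+-mono-≤ (sumW-δ-≤ n v) (sumW-multiplicity-≤ n vs))

multiplicity-0 : ∀ {vs w} → All (_≢ w) vs → multiplicity vs w ≡ 0
multiplicity-0 []                 = refl
multiplicity-0 {v ∷ vs} (v≢w ∷ ≢s) = cong₂ _+_ (δ-≢ v _ v≢w) (multiplicity-0 ≢s)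

multiplicity-unique : ∀ {vs} {Q : Word → Set} → AllPairs _≢_ vs → All Q vs → ∀ w →
                      multiplicity vs w ≡ 0 ⊎ (multiplicity vs w ≡ 1 × Q w)
multiplicity-unique []               []       w = inj₁ refl
multiplicity-unique {v ∷ vs} (≢s ∷ u) (q ∷ qs) w with v ≟ʷ w
... | yes refl rewrite δ-refl v = inj₂ (cong suc (multiplicity-0 (All.map (_∘ sym) ≢s)) , q)
... | no  v≢w rewrite δ-≢ v w v≢w = multiplicity-unique u qs w

-- Orbits and their collisions on prefixes

iter : {A : Set} → (A → A) → ℕ → A → A
iter f zero    x = x
iter f (suc n) x = iter f n (f x)

iter-comm : ∀ {A : Set} (f : A → A) n x → f (iter f n x) ≡ iter f n (f x)
iter-comm f zero    x = refl
iter-comm f (suc n) x = iter-comm f n (f x)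

orbit : (Word → Word) → ℕ → Word → List Word
orbit F zero    w = [ w ]
orbit F (suc m) w = w ∷ orbit F m (F w)

length-orbit : ∀ F m w → length (orbit F m w) ≡ suc m
length-orbit F zero    w = refl
length-orbit F (suc m) w = cong suc (length-orbit F m (F w))

-- Two orbit points are written as Fⁱ(w) and Fⁱ(Fᵈ⁺¹(w)) so that Fⁱ can be cancelled, leaving a
-- return to w itself.
Collision : (Word → Word) → ℕ → ℕ → Word → Set
Collision F K m w = ∃₂ λ i d → i ≤ m × take K (iter F i w) ≡ take K (iter F i (iter F (suc d) w))

meets : ∀ F K v m w → (∃ λ d → take K v ≡ take K (iter F d w)) ⊎ All (λ x → take K v ≢ take K x) (orbit F m w)
meets F K v m w with take K v ≟ʷ take K w
... | yes eq = inj₁ (0 , eq)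
meets F K v zero    w | no ≢w = inj₂ (≢w ∷ [])
meets F K v (suc m) w | no ≢w with meets F K v m (F w)
... | inj₁ (d , eq) = inj₁ (suc d , eq)
... | inj₂ ≢s       = inj₂ (≢w ∷ ≢s)

collision-or-distinct : ∀ F K m w → Collision F K m w ⊎ AllPairs (λ x y → take K x ≢ take K y) (orbit F m w)
collision-or-distinct F K zero    w = inj₂ ([] ∷ [])
collision-or-distinct F K (suc m) w with meets F K w m (F w)
... | inj₁ (d , eq) = inj₁ (0 , d , z≤n , eq)
... | inj₂ ≢s with collision-or-distinct F K m (F w)
... | inj₂ ≢ss = inj₂ (≢s ∷ ≢ss)
... | inj₁ (i , d , i≤m , eq) = inj₁ (suc i , d , s≤s i≤m ,
      trans eq (cong (take K ∘ iter F i) (sym (iter-comm F (suc d) w))))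

take-≤ : ∀ {K M} → K ≤ M → ∀ {v w : Word} → take M v ≡ take M w → take K v ≡ take K w
take-≤ {K} {M} K≤M {v} {w} eq = trans (shorten v) (trans (cong (take K) eq) (sym (shorten w)))
  where
  shorten : ∀ v → take K v ≡ take K (take M v)
  shorten v = sym (trans (take-take K M v) (cong (λ n → take n v) (m≤n⇒m⊓n≡m K≤M)))

≼⇒take : ∀ {v w} → v ≼ w → take (length v) w ≡ v
≼⇒take {[]}    (t , refl) = refl
≼⇒take {a ∷ v} (t , refl) = cong (a ∷_) (≼⇒take {v} (t , refl))

take-≼ : ∀ K (w : Word) → take K w ≼ w
take-≼ K w = drop K w , take++drop≡id K w

take-++-cancel : ∀ x K {v w : Word} → take (length x + K) (x ++ v) ≡ take (length x + K) (x ++ w) → take K v ≡ take K w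
take-++-cancel []      K eq = eq
take-++-cancel (a ∷ x) K eq = take-++-cancel x K (∷-injectiveʳ eq)

-- Left special words

noncommuting⇒nonerasing : ∀ χ → NonCommuting χ → ∀ b → 1 ≤ length (χ b)
noncommuting⇒nonerasing χ nc b with χ b in eq
... | _ ∷ _ = s≤s z≤n
noncommuting⇒nonerasing χ nc false | [] = ⊥-elim (nc (trans (cong (_++ χ true) eq)
  (sym (trans (cong (χ true ++_) eq) (++-identityʳ _)))))
noncommuting⇒nonerasing χ nc true  | [] = ⊥-elim (nc (trans (cong (χ false ++_) eq)
  (trans (++-identityʳ _) (sym (cong (_++ χ false) eq)))))

length-img-≥ : ∀ χ → (∀ b → 1 ≤ length (χ b)) → ∀ w → length w ≤ length (img χ w)
length-img-≥ χ ne []      = z≤n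
length-img-≥ χ ne (a ∷ w) = ≤-trans (+-mono-≤ (ne a) (length-img-≥ χ ne w)) (≤-reflexive (sym (length-++ (χ a))))

weight : Morphism → ℕ
weight χ = length (χ false) + length (χ true)

length-≤-weight : ∀ χ b → length (χ b) ≤ weight χ
length-≤-weight χ false = m≤m+n _ _
length-≤-weight χ true  = m≤n+m _ _

module Lifting (χ : Morphism) (nc : NonCommuting χ) (s : Word) where

  F : Word → Word
  F w = s ++ img χ w

  length-F : ∀ w → length w ≤ length (F w)
  length-F w = ≤-trans (length-img-≥ χ (noncommuting⇒nonerasing χ nc) w) (length-++-≤ʳ (img χ w) {s})

  length-iter : ∀ i w → length w ≤ length (iter F i w)
  length-iter zero    w = ≤-refl
  length-iter (suc i) w = ≤-trans (length-F w) (length-iter i (F w))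

  private
    split : LCP χ
    split = lcp _ χ ≤-refl nc
    p : Word
    p = proj₁ split
    a : Bool
    a = proj₁ (proj₂ split)
    N : ℕ
    N = proj₁ (proj₂ (proj₂ split))
    ℓ : ℕ
    ℓ = length (p ++ [ a ])

  differ : ∀ v w → N ≤ length v → N ≤ length w → take ℓ (img χ (false ∷ v)) ≢ take ℓ (img χ (true ∷ w))
  differ v w N≤v N≤w eq = not-¬ refl (∷-injectiveˡ (++-cancelˡ p _ _
    (trans (sym (≼⇒take (proj₁ (proj₂ (proj₂ (proj₂ split)) v N≤v)))) (trans eq
      (trans (cong (λ n → take n (img χ (true ∷ w))) (trans (length-++ p) (sym (length-++ p))))
        (≼⇒take (proj₂ (proj₂ (proj₂ (proj₂ split)) w N≤w))))))))

  ∷-lift : ∀ x y v w → N ≤ length v → N ≤ length w →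
           take ℓ (img χ (x ∷ v)) ≡ take ℓ (img χ (y ∷ w)) → x ≡ y
  ∷-lift x y v w N≤v N≤w eq with x | y
  ... | false | false = refl
  ... | true  | true  = refl
  ... | false | true  = ⊥-elim (differ v w N≤v N≤w eq)
  ... | true  | false = ⊥-elim (differ w v N≤w N≤v (sym eq))

  -- ℓ letters of the image decide the first letter of the word, and removing its image costs at
  -- most `weight χ` letters. `N` further letters must remain for the last decision.
  img-lift : ∀ K v w → K + N ≤ length v → K + N ≤ length w →
             take (K * weight χ + ℓ) (img χ v) ≡ take (K * weight χ + ℓ) (img χ w) → take K v ≡ take K w
  img-lift zero    v w _ _ _ = refl
  img-lift (suc K) (x ∷ v) (y ∷ w) (s≤s K≤v) (s≤s K≤w) eq
    with ∷-lift x y v w (≤-trans (m≤n+m N K) K≤v) (≤-trans (m≤n+m N K) K≤w)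
           (take-≤ (m≤n+m ℓ (suc K * weight χ)) eq)
  ... | refl = cong (x ∷_) (img-lift K v w K≤v K≤w
        (take-++-cancel (χ x) (K * weight χ + ℓ) (take-≤ bound eq)))
    where
    bound : length (χ x) + (K * weight χ + ℓ) ≤ suc K * weight χ + ℓ
    bound = ≤-trans (+-monoˡ-≤ _ (length-≤-weight χ x)) (≤-reflexive (sym (+-assoc (weight χ) (K * weight χ) ℓ)))

  -- One pair of bounds has to serve all i ≤ C, since the pigeonhole argument tells nothing more
  -- about the index of the collision.
  iter-lift : ∀ C K → ∃₂ λ K′ M → K ≤ K′ × (∀ i → i ≤ C → ∀ v w → M ≤ length v → M ≤ length w →
              take K′ (iter F i v) ≡ take K′ (iter F i w) → take K v ≡ take K w)
  iter-lift zero K = K , 0 , ≤-refl , λ { zero _ v w _ _ eq → eq }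
  iter-lift (suc C) K with iter-lift C (length s + (K * weight χ + ℓ))
  ... | K′ , M , G≤K′ , lift = K′ , M ⊔ (K + N) , K≤K′ , lift′
    where
    K≤K′ : K ≤ K′
    K≤K′ = ≤-trans (≤-trans (≤-reflexive (sym (*-identityʳ K)))
      (*-monoʳ-≤ K (≤-trans (noncommuting⇒nonerasing χ nc false) (length-≤-weight χ false))))
      (≤-trans (m≤m+n (K * weight χ) ℓ) (≤-trans (m≤n+m _ (length s)) G≤K′))
    lift′ : ∀ i → i ≤ suc C → ∀ v w → M ⊔ (K + N) ≤ length v → M ⊔ (K + N) ≤ length w →
            take K′ (iter F i v) ≡ take K′ (iter F i w) → take K v ≡ take K w
    lift′ zero    _         v w _   _   eq = take-≤ K≤K′ eq
    lift′ (suc i) (s≤s i≤C) v w M≤v M≤w eq =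
      img-lift K v w (≤-trans (m≤n⊔m M (K + N)) M≤v) (≤-trans (m≤n⊔m M (K + N)) M≤w)
        (take-++-cancel s _ (lift i i≤C (F v) (F w) (grow v M≤v) (grow w M≤w) eq))
      where
      grow : ∀ v → M ⊔ (K + N) ≤ length v → M ≤ length (F v)
      grow v M≤v = ≤-trans (m≤m⊔n M (K + N)) (≤-trans M≤v (length-F v))

module Special
  (L : Word → Set) (L-⊑ : ∀ {v w} → v ⊑ w → L w → L v)
  (extˡ : ∀ {w} → L w → ∃ λ a → L (a ∷ w)) (L-bar : ∀ {w} → L w → L (bar w))
  (L? : ∀ w → Dec (L w))
  (C : ℕ) (complexity : ∀ n → 1 ≤ n → sumW n (λ w → if does (L? w) then 1 else 0) ≤ C * n)
  where

  LS : Word → Set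
  LS w = ∀ a → L (a ∷ w)

  LS-bar : ∀ {w} → LS w → LS (bar w)
  LS-bar {w} ls a = subst (λ b → L (b ∷ bar w)) (not-involutive a) (L-bar (ls (not a)))

  LS-≼ : ∀ {v w} → v ≼ w → LS w → LS v
  LS-≼ v≼w ls a = L-⊑ (≼⇒⊑ (++-mono-≼ [ a ] v≼w)) (ls a)

  extendˡ : ∀ n {w} → L w → ∃ λ y → n ≤ length y × L (y ++ w)
  extendˡ zero    l = [] , z≤n , l
  extendˡ (suc n) l with extendˡ n l
  ... | y , n≤y , l′ with extˡ l′
  ... | a , l″ = a ∷ y , s≤s n≤y , l″

  indicator : Word → ℕ
  indicator w = if does (L? w) then 1 else 0

  indicator-1 : ∀ {w} → L w → indicator w ≡ 1
  indicator-1 {w} l with L? w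
  ... | yes _ = refl
  ... | no ¬l = ⊥-elim (¬l l)

  indicator-≤1 : ∀ w → indicator w ≤ 1
  indicator-≤1 w with L? w
  ... | yes _ = ≤-refl
  ... | no _  = z≤n

  -- Every word of `L` has at least one left extension in `L`, and a left special word has two.
  complexity-step : ∀ n {vs} → AllPairs _≢_ vs → All LS vs → All (λ v → length v ≡ n) vs →
                    sumW n indicator + length vs ≤ sumW (suc n) indicator
  complexity-step n {vs} unique lss lens = begin
    sumW n indicator + length vs                        ≡⟨ cong (sumW n indicator +_) (sym (sumW-multiplicity n vs lens)) ⟩
    sumW n indicator + sumW n (multiplicity vs)         ≡⟨ sym (sumW-+ n indicator (multiplicity vs)) ⟩
    sumW n (λ w → indicator w + multiplicity vs w)      ≤⟨ sumW-mono n (λ w _ → pointwise w) ⟩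
    sumW n (λ w → indicator (false ∷ w) + indicator (true ∷ w)) ≡⟨ sumW-+ n (indicator ∘ (false ∷_)) (indicator ∘ (true ∷_)) ⟩
    sumW (suc n) indicator                              ∎
    where
    open ≤-Reasoning
    extends : ∀ w → indicator w ≤ indicator (false ∷ w) + indicator (true ∷ w)
    extends w with L? w
    ... | no _  = z≤n
    ... | yes l with extˡ l
    ... | false , l′ = ≤-trans (≤-reflexive (sym (indicator-1 l′))) (m≤m+n _ (indicator (true ∷ w)))
    ... | true  , l′ = ≤-trans (≤-reflexive (sym (indicator-1 l′))) (m≤n+m _ (indicator (false ∷ w)))
    pointwise : ∀ w → indicator w + multiplicity vs w ≤ indicator (false ∷ w) + indicator (true ∷ w)
    pointwise w with multiplicity-unique unique lss w
    ... | inj₁ m≡0 = ≤-trans (≤-reflexive (trans (cong (indicator w +_) m≡0) (+-identityʳ _))) (extends w)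
    ... | inj₂ (m≡1 , ls) = ≤-trans (+-mono-≤ (indicator-≤1 w) (≤-reflexive m≡1))
          (≤-reflexive (sym (cong₂ _+_ (indicator-1 (ls false)) (indicator-1 (ls true)))))

  record Good (χ : Morphism) : Set where
    field
      preserves    : ∀ {w} → L w → L (img χ w)
      noncommuting : NonCommuting χ
  open Good

  -- s is the longest common suffix of the words χ(y0) and χ(z1) with y and z long.
  common-suffix : ∀ χ → Good χ → ∃ λ s → ∀ w → LS w → LS (s ++ img χ w)
  common-suffix χ g with lcp _ (rev χ) ≤-refl (rev-noncommuting χ (noncommuting g))
  ... | p , a , N , q = reverse p , special
    where
    reach : ∀ {w} b c → (∀ z → N ≤ length z → p ++ [ b ] ≼ img (rev χ) (c ∷ z)) → L (c ∷ w) → L (b ∷ reverse p ++ img χ w)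
    reach {w} b c q′ l with extendˡ N l
    ... | y , N≤y , l′ with q′ (reverse y) (≤-trans N≤y (≤-reflexive (sym (length-reverse y))))
    ... | t , eq = L-⊑ (reverse t , [] , (begin
      img χ (y ++ c ∷ w)                           ≡⟨ cong (img χ) (sym (++-assoc y [ c ] w)) ⟩
      img χ ((y ++ [ c ]) ++ w)                    ≡⟨ img-++ χ (y ++ [ c ]) w ⟩
      img χ (y ++ [ c ]) ++ img χ w                ≡⟨ cong (λ x → img χ x ++ img χ w) (sym snoc) ⟩
      img χ (reverse (c ∷ reverse y)) ++ img χ w   ≡⟨ cong (_++ img χ w) (sym (reverse-involutive _)) ⟩
      reverse (reverse (img χ (reverse (c ∷ reverse y)))) ++ img χ w ≡⟨ cong (λ x → reverse x ++ img χ w) (sym (img-rev χ (c ∷ reverse y))) ⟩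
      reverse (img (rev χ) (c ∷ reverse y)) ++ img χ w ≡⟨ cong (λ x → reverse x ++ img χ w) (sym eq) ⟩
      reverse ((p ++ [ b ]) ++ t) ++ img χ w       ≡⟨ cong (_++ img χ w) (trans (reverse-++ (p ++ [ b ]) t) (cong (reverse t ++_) (reverse-++ p [ b ]))) ⟩
      (reverse t ++ b ∷ reverse p) ++ img χ w      ≡⟨ ++-assoc (reverse t) _ _ ⟩
      reverse t ++ b ∷ reverse p ++ img χ w        ≡⟨ cong (reverse t ++_) (sym (++-identityʳ _)) ⟩
      reverse t ++ (b ∷ reverse p ++ img χ w) ++ [] ∎)) (preserves g l′)
      where
      open ≡-Reasoning
      snoc : reverse (c ∷ reverse y) ≡ y ++ [ c ]
      snoc = trans (unfold-reverse c (reverse y)) (cong (_++ [ c ]) (reverse-involutive y))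
    both : ∀ {w} b → L (a ∷ w) → L (not a ∷ w) → L (b ∷ w)
    both b l l′ with a Bool.≟ b
    ... | yes refl = l
    ... | no a≢b rewrite ≢⇒≡not a≢b = l′
    special : ∀ w → LS w → LS (reverse p ++ img χ w)
    special w ls b = both b (reach a false (λ z N≤z → proj₁ (q z N≤z)) (ls false))
                          (reach (not a) true (λ z N≤z → proj₂ (q z N≤z)) (ls true))

  -- Were the K-prefixes along the orbit of w distinct, there would be C + 1 left special words
  -- of every length between K and |w|, contradicting the linear bound on the complexity.
  recurrence : ∀ χ → Good χ → ∀ s → (∀ w → LS w → LS (s ++ img χ w)) → ∀ K →
    ∃ λ N → ∀ w → LS w → N ≤ length w → ∃ λ m → take K w ≡ take K (iter (λ v → s ++ img χ v) (suc m) w)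
  recurrence χ g s LS-F K with Lifting.iter-lift χ (noncommuting g) s C K
  ... | K′ , M , _ , lift = M ⊔ (K′ + suc (C * K′)) , recur
    where
    open Lifting χ (noncommuting g) s using (F; length-F; length-iter)
    -- Growth by C + 1 at each of T steps exceeds the bound C(K′ + T) exactly when T > CK′.
    T = suc (C * K′)
    LS-orbit : ∀ {n} m {w} → LS w → n ≤ length w → All (λ v → LS v × n ≤ length v) (orbit F m w)
    LS-orbit zero    ls n≤w = (ls , n≤w) ∷ []
    LS-orbit (suc m) {w} ls n≤w = (ls , n≤w) ∷ LS-orbit m (LS-F w ls) (≤-trans n≤w (length-F w))
    recur : ∀ w → LS w → M ⊔ (K′ + T) ≤ length w → ∃ λ m → take K w ≡ take K (iter F (suc m) w)
    recur w ls le with collision-or-distinct F K′ C w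
    ... | inj₁ (i , d , i≤C , eq) = d , lift i i≤C w (iter F (suc d) w) M≤w (≤-trans M≤w (length-iter (suc d) w)) eq
      where
      M≤w : M ≤ length w
      M≤w = ≤-trans (m≤m⊔n M _) le
    ... | inj₂ distinct = ⊥-elim (<⇒≱ too-many (complexity (K′ + T) (≤-trans (s≤s z≤n) (m≤n+m T K′))))
      where
      growth : ∀ t → K′ + t ≤ length w → t * suc C ≤ sumW (K′ + t) indicator
      growth zero    _ = z≤n
      growth (suc t) le′ = begin
        suc C + t * suc C                          ≡⟨ +-comm (suc C) (t * suc C) ⟩
        t * suc C + suc C                          ≤⟨ +-monoˡ-≤ (suc C) (growth t (≤-trans (n≤1+n _) n<w)) ⟩
        sumW n indicator + suc C                   ≡⟨ cong (sumW n indicator +_) (sym (trans (length-map (take n) (orbit F C w)) (length-orbit F C w))) ⟩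
        sumW n indicator + length vs               ≤⟨ complexity-step n unique lss lens ⟩
        sumW (suc n) indicator                     ≡⟨ cong (λ k → sumW k indicator) (sym (+-suc K′ t)) ⟩
        sumW (K′ + suc t) indicator                ∎
        where
        open ≤-Reasoning
        n = K′ + t
        n<w : suc n ≤ length w
        n<w = ≤-trans (≤-reflexive (sym (+-suc K′ t))) le′
        vs = map (take n) (orbit F C w)
        unique : AllPairs _≢_ vs
        unique = AllPairs.map⁺ (AllPairs.map (λ ≢K eq → ≢K (take-≤ (m≤m+n K′ t) eq)) distinct)
        lss : All LS vs
        lss = All.map⁺ (All.map (λ {v} q → LS-≼ (take-≼ n v) (proj₁ q)) (LS-orbit C ls n<w))
        lens : All (λ v → length v ≡ n) vs
        lens = All.map⁺ (All.map (λ {v} q → trans (length-take n v) (m≤n⇒m⊓n≡m (≤-trans (n≤1+n n) (proj₂ q)))) (LS-orbit C ls n<w))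
      too-many : C * (K′ + T) < sumW (K′ + T) indicator
      too-many = ≤-trans (≤-reflexive (trans (cong suc (trans (*-distribˡ-+ C K′ T) (cong (C * K′ +_) (*-comm C T)))) (sym (*-suc T C))))
        (growth T (≤-trans (m≤n⊔m M (K′ + T)) le))

  module _ (long : ∀ n → ¬ ¬ ∃ λ w → LS w × n ≤ length w) where

    long-starting : ∀ a n → ¬ ¬ ∃ λ w → LS w × n ≤ length w × Starts a w
    long-starting a n none = long (suc n) λ where
      (b ∷ w , ls , n<w) → case a Bool.≟ b of λ where
        (yes refl) → none (b ∷ w , ls , ≤-trans (n≤1+n n) n<w , w , refl)
        (no a≢b)   → none (bar (b ∷ w) , LS-bar ls ,
          ≤-trans (n≤1+n n) (≤-trans n<w (≤-reflexive (sym (length-bar (b ∷ w))))) ,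
          bar w , cong (_∷ bar w) (trans (cong not (≢⇒≡not a≢b)) (not-involutive a)))

    -- By recurrence a long left special word would begin with s, and so would its complement, which
    -- is left special too.
    common-suffix-[] : ∀ χ → Good χ → ∀ s → (∀ w → LS w → LS (s ++ img χ w)) → s ≡ []
    common-suffix-[] χ g []          LS-F = refl
    common-suffix-[] χ g s@(a ∷ s′) LS-F with recurrence χ g s LS-F (length s)
    ... | N , recur = ⊥-elim (long N λ { (w , ls , N≤w) → clash (begins w ls N≤w)
          (begins (bar w) (LS-bar ls) (≤-trans N≤w (≤-reflexive (sym (length-bar w))))) })
      where
      begins : ∀ w → LS w → N ≤ length w → Starts a w
      begins w ls N≤w with recur w ls N≤w
      ... | m , eq with trans (sym (take++drop≡id (length s) w)) (cong (_++ drop (length s) w)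
            (trans eq (trans (cong (take (length s)) (sym (iter-comm _ m w))) (≼⇒take (≼-++ s)))))
      ... | w≡ = _ , w≡
      clash : ∀ {w} → Starts a w → ¬ Starts a (bar w)
      clash (_ , refl) (_ , eq) = not-¬ refl (sym (∷-injectiveˡ eq))

    LS-img : ∀ χ → Good χ → ∀ w → LS w → LS (img χ w)
    LS-img χ g w ls = go (common-suffix χ g)
      where
      go : (∃ λ s → ∀ w → LS w → LS (s ++ img χ w)) → LS (img χ w)
      go (s , LS-F) = go′ s LS-F (common-suffix-[] χ g s LS-F)
        where
        go′ : ∀ s → (∀ w → LS w → LS (s ++ img χ w)) → s ≡ [] → LS (img χ w)
        go′ .[] LS-F refl = LS-F w ls

    img-recurrence : ∀ χ → Good χ → ∀ K →
      ∃ λ N → ∀ w → LS w → N ≤ length w → ∃ λ m → take K w ≡ take K (img χ (iter (img χ) m w))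
    img-recurrence χ g K = proj₁ rec , λ w ls N≤w → convert w (proj₂ rec w ls N≤w)
      where
      rec : ∃ λ N → ∀ w → LS w → N ≤ length w → ∃ λ m → take K w ≡ take K (iter (img χ) (suc m) w)
      rec = recurrence χ g [] (LS-img χ g) K
      convert : ∀ w → (∃ λ m → take K w ≡ take K (iter (img χ) (suc m) w)) →
                ∃ λ m → take K w ≡ take K (img χ (iter (img χ) m w))
      convert w (m , eq) = m , trans eq (cong (take K) (sym (iter-comm (img χ) m w)))

    -- Every long left special word begins like an image under χ, hence would begin with a;
    -- complementation supplies one with the other first letter.
    first-letters : ∀ χ → Good χ → ∀ a → ¬ (Starts a (χ false) × Starts a (χ true))
    first-letters χ g a (s₀ , s₁) = long-starting (not a) (suc N) λ { (w , ls , N<w , starts) →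
      clash w (proj₂ rec w ls (≤-trans (n≤1+n N) N<w)) (≤-trans (s≤s z≤n) N<w) starts }
      where
      rec : ∃ λ N → ∀ w → LS w → N ≤ length w → ∃ λ m → take 1 w ≡ take 1 (img χ (iter (img χ) m w))
      rec = img-recurrence χ g 1
      N : ℕ
      N = proj₁ rec
      same-start : ∀ v w → take 1 v ≡ take 1 w → Starts (not a) v → ¬ Starts a w
      same-start _ _ eq (_ , refl) (_ , refl) = not-¬ refl (sym (∷-injectiveˡ eq))
      begins : ∀ v → 1 ≤ length v → Starts a (img χ v)
      begins (false ∷ v) _ = starts-++ s₀ (img χ v)
      begins (true ∷ v)  _ = starts-++ s₁ (img χ v)
      clash : ∀ w → (∃ λ m → take 1 w ≡ take 1 (img χ (iter (img χ) m w))) → 1 ≤ length w → ¬ Starts (not a) w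
      clash w (m , eq) 1≤w s = same-start w (img χ x) eq s
        (begins x (≤-trans 1≤w (Lifting.length-iter χ (noncommuting g) [] m w)))
        where
        x : Word
        x = iter (img χ) m w

    -- Not vacuous: by `long-starting`, left special words of any length with first letter c cannot
    -- fail to exist.
    Limit : Bool → Word → Set
    Limit c v = ∃ λ N → ∀ w → LS w → N ≤ length w → Starts c w → v ≼ w

    limit-[_] : ∀ c → Limit c [ c ]
    limit-[ c ] = 0 , λ { _ _ _ (t , refl) → t , refl }

    limit-≼ : ∀ {c v w} → v ≼ w → Limit c w → Limit c v
    limit-≼ v≼w (N , below) = N , λ x ls N≤x s → ≼-trans v≼w (below x ls N≤x s)

    -- The long left special word having both as prefixes exists only up to double negation, which
    -- suffices because comparability is decidable.
    limit-comparable : ∀ {c v w} → Limit c v → Limit c w → Comparable v w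
    limit-comparable {c} {v} {w} (M , v≼) (N , w≼) = decidable-stable (comparable? v w) λ incomparable →
      long-starting c (M ⊔ N) λ { (x , ls , le , s) → incomparable (prefixes-comparable
        (w≼ x ls (≤-trans (m≤n⊔m M N) le) s) (v≼ x ls (≤-trans (m≤m⊔n M N) le) s)) }

    -- w agrees on |χ(v)| letters with χ(x) for an iterate x of w; this x is left special, long and
    -- still begins with c, so v begins x.
    limit-img : ∀ χ → Good χ → (∀ b → Starts b (χ b)) → ∀ {c v} → Limit c v → Limit c (img χ v)
    limit-img χ g fix {c} {v} (N , below) = proj₁ rec ⊔ N , λ w ls le starts →
      conclude w ls (≤-trans (m≤n⊔m (proj₁ rec) N) le) starts (proj₂ rec w ls (≤-trans (m≤m⊔n (proj₁ rec) N) le))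
      where
      K : ℕ
      K = length (img χ v)
      rec : ∃ λ N → ∀ w → LS w → N ≤ length w → ∃ λ m → take K w ≡ take K (img χ (iter (img χ) m w))
      rec = img-recurrence χ g K
      LS-iter : ∀ m w → LS w → LS (iter (img χ) m w)
      LS-iter zero    w ls = ls
      LS-iter (suc m) w ls = LS-iter m (img χ w) (LS-img χ g w ls)
      starts-iter : ∀ m w → Starts c w → Starts c (iter (img χ) m w)
      starts-iter zero    w s          = s
      starts-iter (suc m) w (t , refl) = starts-iter m (img χ w) (starts-++ (fix c) (img χ t))
      conclude : ∀ w → LS w → N ≤ length w → Starts c w →
                 (∃ λ m → take K w ≡ take K (img χ (iter (img χ) m w))) → img χ v ≼ w
      conclude w ls N≤w starts (m , eq) = subst (_≼ w) (trans eq (≼⇒take (img-mono-≼ χ v≼x))) (take-≼ K w)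
        where
        x : Word
        x = iter (img χ) m w
        v≼x : v ≼ x
        v≼x = below x (LS-iter m w ls) (≤-trans N≤w (Lifting.length-iter χ (noncommuting g) [] m w)) (starts-iter m w starts)

-- The language of a fixed point

∈⇒⊑ : ∀ {a w} → a ∈ w → [ a ] ⊑ w
∈⇒⊑ a∈w = let x , y , w≡ = ∈-∃++ a∈w in x , y , w≡

⊑-length : ∀ {v w} → v ⊑ w → length v ≤ length w
⊑-length {v} (x , y , refl) = ≤-trans (length-++-≤ˡ v) (length-++-≤ʳ (v ++ y) {x})

length-img-≤ : ∀ χ w → length (img χ w) ≤ weight χ * length w
length-img-≤ χ []      = z≤n
length-img-≤ χ (a ∷ w) = ≤-trans (≤-reflexive (length-++ (χ a)))
  (≤-trans (+-mono-≤ (length-≤-weight χ a) (length-img-≤ χ w)) (≤-reflexive (sym (*-suc (weight χ) (length w)))))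

∈⇒length-≤-img : ∀ χ {a w} → a ∈ w → length (χ a) ≤ length (img χ w)
∈⇒length-≤-img χ {a} {w} a∈w = subst (λ v → length v ≤ length (img χ w)) (img-letter χ a)
  (⊑-length {img χ [ a ]} {img χ w} (img-mono-⊑ χ {[ a ]} {w} (∈⇒⊑ a∈w)))

weight-≤-img : ∀ χ w → (∀ c → c ∈ w) → weight χ ≤ length (img χ w)
weight-≤-img χ []          all = case all false of λ ()
weight-≤-img χ (false ∷ w) all with all true
... | there 1∈w = ≤-trans (+-monoʳ-≤ (length (χ false)) (∈⇒length-≤-img χ 1∈w)) (≤-reflexive (sym (length-++ (χ false))))
weight-≤-img χ (true ∷ w)  all with all false
... | there 0∈w = ≤-trans (≤-trans (≤-reflexive (+-comm (length (χ false)) _)) (+-monoʳ-≤ (length (χ true)) (∈⇒length-≤-img χ 0∈w)))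
  (≤-reflexive (sym (length-++ (χ true))))

img-identity : ∀ w → img [_] w ≡ w
img-identity = concatMap-pure

img-pow-suc : ∀ φ n w → img (pow φ (suc n)) w ≡ img φ (img (pow φ n) w)
img-pow-suc φ n w = sym (img-∘ φ (pow φ n) w)

pow-+ : ∀ φ m n b → pow φ (m + n) b ≡ img (pow φ m) (pow φ n b)
pow-+ φ zero    n b = sym (img-identity (pow φ n b))
pow-+ φ (suc m) n b = trans (cong (img φ) (pow-+ φ m n b)) (sym (img-pow-suc φ m (pow φ n b)))

-- No block is shorter than w, so an occurrence starting in one block ends at the latest in the
-- next.
two-blocks : ∀ θ N → (∀ b → N ≤ length (θ b)) → ∀ a b v w → w ⊑ img θ (a ∷ b ∷ v) → length w ≤ N →
             ∃₂ λ c d → c ∷ d ∷ [] ⊑ a ∷ b ∷ v × w ⊑ img θ (c ∷ d ∷ [])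
two-blocks θ N N≤ a b v w (x , y , eq) w≤N = go (levi (θ a) x eq)
  where
  later : ∀ v → w ⊑ img θ (b ∷ v) → ∃₂ λ c d → c ∷ d ∷ [] ⊑ a ∷ b ∷ v × w ⊑ img θ (c ∷ d ∷ [])
  later []      w⊑ = a , b , ⊑-refl , ⊑-++ˡ (θ a) w⊑
  later (c ∷ v) w⊑ = let d , e , de⊑ , w⊑′ = two-blocks θ N N≤ b c v w w⊑ w≤N in d , e , ⊑-++ˡ [ a ] de⊑ , w⊑′
  go : (∃ λ z → x ≡ θ a ++ z × img θ (b ∷ v) ≡ z ++ w ++ y) ⊎ (∃ λ z → θ a ≡ x ++ z × w ++ y ≡ z ++ img θ (b ∷ v)) →
       ∃₂ λ c d → c ∷ d ∷ [] ⊑ a ∷ b ∷ v × w ⊑ img θ (c ∷ d ∷ [])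
  go (inj₁ (z , _ , eq′)) = later v (z , y , eq′)
  go (inj₂ (z , θa≡ , eq′)) = a , b , ([] , v , refl) ,
    subst (w ⊑_) (trans (sym (++-assoc x z (θ b))) (trans (cong (_++ θ b) (sym θa≡)) (sym (img-pair θ a b))))
      (⊑-++ˡ x (≼⇒⊑ (comparable-length
        (prefixes-comparable (img θ v , trans (++-assoc z (θ b) (img θ v)) (sym eq′)) (≼-++ w))
        (≤-trans w≤N (≤-trans (N≤ b) (length-++-≤ʳ (θ b) {z}))))))

-- An occurrence may start with part of a block, of length at most `weight θ`; the next block fits
-- into what is left.
contains-block : ∀ θ → 1 ≤ weight θ → ∀ x v → v ⊑ img θ x → weight θ + weight θ ≤ length v → ∃ λ c → θ c ⊑ v
contains-block θ 1≤ []      v v⊑ le = ⊥-elim (<⇒≱ (≤-trans 1≤ (≤-trans (m≤m+n _ _) le)) (⊑-length v⊑))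
contains-block θ 1≤ (a ∷ x) v (y , t , eq) le = go (levi (θ a) y eq)
  where
  inside : ∀ z x → θ a ≡ y ++ z → v ++ t ≡ z ++ img θ x → ∃ λ c → θ c ⊑ v
  z≤ : ∀ z → θ a ≡ y ++ z → length z ≤ weight θ
  z≤ z θa≡ = ≤-trans (length-++-≤ʳ z {y}) (≤-trans (≤-reflexive (cong length (sym θa≡))) (length-≤-weight θ a))
  inside z []      θa≡ eq′ = ⊥-elim (<⇒≱ (≤-trans (+-monoˡ-≤ (weight θ) 1≤) le)
    (≤-trans (length-++-≤ˡ v) (≤-trans (≤-reflexive (cong length (trans eq′ (++-identityʳ z)))) (z≤ z θa≡))))
  inside z (b ∷ x) θa≡ eq′ = b , ⊑-trans (z , [] , cong (z ++_) (sym (++-identityʳ (θ b)))) (≼⇒⊑ (comparable-length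
    (prefixes-comparable (≼-++ v) (img θ x , trans (++-assoc z (θ b) (img θ x)) (sym eq′)))
    (≤-trans (≤-reflexive (length-++ z)) (≤-trans (+-mono-≤ (z≤ z θa≡) (length-≤-weight θ b)) le))))
  go : (∃ λ z → y ≡ θ a ++ z × img θ x ≡ z ++ v ++ t) ⊎ (∃ λ z → θ a ≡ y ++ z × v ++ t ≡ z ++ img θ x) → ∃ λ c → θ c ⊑ v
  go (inj₁ (z , _ , eq′))   = contains-block θ 1≤ x v (z , t , eq′) le
  go (inj₂ (z , θa≡ , eq′)) = inside z x θa≡ eq′

open import Data.List.Membership.DecPropositional _≟ʷ_ using (_∈?_)

windows : ℕ → Word → List Word
windows N []      = [ [] ]
windows N (a ∷ G) = take N (a ∷ G) ∷ windows N G

length-windows : ∀ N G → length (windows N G) ≡ suc (length G)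
length-windows N []      = refl
length-windows N (a ∷ G) = cong suc (length-windows N G)

⊑⇒∈-windows : ∀ {w G} → w ⊑ G → w ∈ windows (length w) G
⊑⇒∈-windows {w} (x , y , refl) = find x
  where
  head-∈ : ∀ N G → take N G ∈ windows N G
  head-∈ N []      = here (take-[] N)
  head-∈ N (a ∷ G) = here refl
  find : ∀ x → w ∈ windows (length w) (x ++ w ++ y)
  find []      = subst (_∈ windows (length w) (w ++ y)) (≼⇒take (≼-++ w)) (head-∈ (length w) (w ++ y))
  find (a ∷ x) = there (find x)

∈-windows⇒⊑ : ∀ N {w} G → w ∈ windows N G → w ⊑ G
∈-windows⇒⊑ N []      (here refl) = ⊑-refl
∈-windows⇒⊑ N (a ∷ G) (here refl) = ≼⇒⊑ (take-≼ N (a ∷ G))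
∈-windows⇒⊑ N (a ∷ G) (there w∈)  = ⊑-++ˡ [ a ] (∈-windows⇒⊑ N G w∈)

multiplicity-∈ : ∀ {vs w} → w ∈ vs → 1 ≤ multiplicity vs w
multiplicity-∈ {v ∷ vs} {w} (here refl) = ≤-trans (≤-reflexive (sym (δ-refl v))) (m≤m+n _ _)
multiplicity-∈ {v ∷ vs} {w} (there w∈)  = ≤-trans (multiplicity-∈ w∈) (m≤n+m _ (δ v w))

¬¬-uniform : ∀ (Q : Bool → ℕ → Set) → (∀ a {m n} → m ≤ n → Q a m → Q a n) →
             (∀ a → ¬ ¬ ∃ (Q a)) → ¬ ¬ ∃ λ n → ∀ a → Q a n
¬¬-uniform Q mono ex none = ex false λ { (m , q₀) → ex true λ { (n , q₁) →
  none (m ⊔ n , λ { false → mono false (m≤m⊔n m n) q₀ ; true → mono true (m≤n⊔m m n) q₁ }) } }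

module Prefixes (u : InfWord) where

  Pfx : Word → Set
  Pfx w = IsPrefixOf w u

  -- Factors are described through prefixes of u because the fixed point equation speaks of
  -- prefixes.
  L : Word → Set
  L w = ∃ λ x → Pfx (x ++ w)

  length-pref : ∀ v n → length (pref v n) ≡ n
  length-pref v zero    = refl
  length-pref v (suc n) = trans (length-++ (pref v n)) (trans (cong (_+ 1) (length-pref v n)) (+-comm n 1))

  pfx-pref : ∀ n → Pfx (pref u n)
  pfx-pref n = cong (pref u) (length-pref u n)

  pref-+ : ∀ m n → pref u (m + n) ≡ pref u m ++ pref (shift u m) n
  pref-+ m zero    = trans (cong (pref u) (+-identityʳ m)) (sym (++-identityʳ (pref u m)))
  pref-+ m (suc n) = trans (cong (pref u) (+-suc m n))
    (trans (cong (_++ [ u (m + n) ]) (pref-+ m n)) (++-assoc (pref u m) _ _))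

  pref-mono : ∀ {m n} → m ≤ n → pref u m ≼ pref u n
  pref-mono {m} {n} m≤n = pref (shift u m) (n ∸ m) , trans (sym (pref-+ m (n ∸ m))) (cong (pref u) (m+[n∸m]≡n m≤n))

  pfx-ordered : ∀ {v w} → Pfx v → Pfx w → length v ≤ length w → v ≼ w
  pfx-ordered pv pw le = subst₂ _≼_ pv pw (pref-mono le)

  pfx-≼ : ∀ {v w} → v ≼ w → Pfx w → Pfx v
  pfx-≼ {v} {w} v≼w pw = comparable-≡
    (prefixes-comparable v≼w (subst (pref u (length v) ≼_) pw (pref-mono (≼-length v≼w))))
    (length-pref u (length v))

  pfx-++ : ∀ v {w} → Pfx (v ++ w) → Pfx v
  pfx-++ v = pfx-≼ (≼-++ v)

  pfx-next : ∀ {w} → Pfx w → Pfx (w ++ [ u (length w) ])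
  pfx-next {w} pw = trans (cong (pref u) (trans (length-++ w) (+-comm (length w) 1))) (cong (_++ [ u (length w) ]) pw)

  pfx-last : ∀ w {a} → Pfx (w ++ [ a ]) → a ≡ u (length w)
  pfx-last w {a} p = sym (∷-injectiveˡ (proj₂ (++-split (pref u (length w)) w
    (trans (cong (pref u) (sym (trans (length-++ w) (+-comm (length w) 1)))) p) (length-pref u (length w)))))

  L-⊑ : ∀ {v w} → v ⊑ w → L w → L v
  L-⊑ {v} (y , z , refl) (x , p) = x ++ y ,
    pfx-++ ((x ++ y) ++ v) (subst Pfx (trans (sym (++-assoc x y (v ++ z))) (sym (++-assoc (x ++ y) v z))) p)

  pfx⇒L : ∀ {w} → Pfx w → L w
  pfx⇒L p = [] , p

  factor⇒L : ∀ {w} → IsFactor w u → L w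
  factor⇒L {w} (i , p) = pref u i , trans (cong (pref u) (trans (length-++ (pref u i)) (cong (_+ length w) (length-pref u i))))
    (trans (pref-+ i (length w)) (cong (pref u i ++_) p))

  L-next : ∀ {w} → L w → ∃ λ a → L (w ++ [ a ])
  L-next {w} (x , p) = u (length (x ++ w)) , x , subst Pfx (++-assoc x w _) (pfx-next p)

  L-pair : ∀ i → L (u i ∷ u (suc i) ∷ [])
  L-pair i = pref u i , subst Pfx (++-assoc (pref u i) _ _) (pfx-pref (suc (suc i)))

  -- This is u = yu tested on prefixes; comparing last letters gives u(|y| + m) = u(m).
  periodic : ∀ y n → y ≢ [] → (∀ m → n ≤ m → Pfx (y ++ pref u m)) → IsEventuallyPeriodic u
  periodic []      n y≢[] _   = ⊥-elim (y≢[] refl)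
  periodic y@(_ ∷ _) n _  pre = length y , n , s≤s z≤n , λ i n≤i →
    sym (trans (pfx-last (y ++ pref u i) (subst Pfx (sym (++-assoc y (pref u i) _)) (pre (suc i) (≤-trans n≤i (n≤1+n i)))))
      (cong u (trans (length-++ y) (trans (cong (length y +_) (length-pref u i)) (+-comm (length y) i)))))

  pref-∷ : ∀ n → ∃ λ w → pref u (suc n) ≡ u 0 ∷ w × length w ≡ n
  pref-∷ n = pref (shift u 1) n , pref-+ 1 n , length-pref (shift u 1) n

module FixedPoint (φ : Morphism) (u : InfWord) (primitive′ : IsPrimitive φ) (fixed : IsFixedPoint φ u) where
  open Prefixes u public

  k : ℕ
  k = proj₁ primitive′

  mixing : ∀ b c → c ∈ pow φ k b
  mixing = proj₂ primitive′

  -- Otherwise all φⁿ⁺¹(b) are empty, while φ⁰(b) = b lacks the other letter, so no power of φ sends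
  -- b to a word with both letters.
  nonerasing : ∀ b → 1 ≤ length (φ b)
  nonerasing b = nonempty (φ b) refl
    where
    erased : φ b ≡ [] → ∀ n → pow φ (suc n) b ≡ []
    erased e zero    = trans (img-letter φ b) e
    erased e (suc n) = cong (img φ) (erased e n)
    absurd : φ b ≡ [] → ∀ n → (∀ c → c ∈ pow φ n b) → ⊥
    absurd e zero    all with all (not b)
    ... | here eq = not-¬ refl (sym eq)
    absurd e (suc n) all with subst (b ∈_) (erased e n) (all b)
    ... | ()
    nonempty : ∀ w → φ b ≡ w → 1 ≤ length (φ b)
    nonempty []      e = ⊥-elim (absurd e k (mixing b))
    nonempty (a ∷ w) e = subst (λ v → 1 ≤ length v) (sym e) (s≤s z≤n)

  pow-nonerasing : ∀ n b → 1 ≤ length (pow φ n b)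
  pow-nonerasing zero    b = ≤-refl
  pow-nonerasing (suc n) b = ≤-trans (pow-nonerasing n b) (length-img-≥ φ nonerasing (pow φ n b))

  pfx-img : ∀ {w} → Pfx w → Pfx (img φ w)
  pfx-img {w} p = subst (Pfx ∘ img φ) p (fixed (length w))

  pfx-pow : ∀ n {w} → Pfx w → Pfx (img (pow φ n) w)
  pfx-pow zero    {w} p = subst Pfx (sym (img-identity w)) p
  pfx-pow (suc n) {w} p = subst Pfx (sym (img-pow-suc φ n w)) (pfx-img (pfx-pow n p))

  pfx-pow-first : ∀ n → Pfx (pow φ n (u 0))
  pfx-pow-first n = subst Pfx (img-letter (pow φ n) (u 0)) (pfx-pow n {[ u 0 ]} (pfx-pref 1))

  L-φ : ∀ {w} → L w → L (img φ w)
  L-φ {w} (x , p) = img φ x , subst Pfx (img-++ φ x w) (pfx-img p)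

  pow-⊑ : ∀ n a b → pow φ n a ⊑ pow φ (n + k) b
  pow-⊑ n a b = subst₂ _⊑_ (img-letter (pow φ n) a) (sym (pow-+ φ n k b)) (img-mono-⊑ (pow φ n) (∈⇒⊑ (mixing b a)))

  weight-≤-pow : ∀ n b → weight (pow φ n) ≤ length (pow φ (n + k) b)
  weight-≤-pow n b = subst (λ w → weight (pow φ n) ≤ length w) (sym (pow-+ φ n k b)) (weight-≤-img (pow φ n) (pow φ k b) (mixing b))

  weight-pow-≤ : ∀ i n → weight (pow φ (i + n)) ≤ weight φ ^ i * weight (pow φ n)
  weight-pow-≤ zero    n = ≤-reflexive (sym (+-identityʳ _))
  weight-pow-≤ (suc i) n = begin
    weight (pow φ (suc i + n))                       ≤⟨ +-mono-≤ (length-img-≤ φ (pow φ (i + n) false)) (length-img-≤ φ (pow φ (i + n) true)) ⟩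
    W * length (pow φ (i + n) false) + W * length (pow φ (i + n) true) ≡⟨ sym (*-distribˡ-+ W _ _) ⟩
    W * weight (pow φ (i + n))                       ≤⟨ *-monoʳ-≤ W (weight-pow-≤ i n) ⟩
    W * (W ^ i * weight (pow φ n))                   ≡⟨ sym (*-assoc W (W ^ i) _) ⟩
    W ^ suc i * weight (pow φ n)                     ∎
    where
    open ≤-Reasoning
    W = weight φ

  -- The summand 2 is the weight of φ⁰, needed at N = 0; the power bounds the growth over k
  -- applications of φ.
  C′ : ℕ
  C′ = weight φ ^ k + 2

  -- A level becomes too small only when its weight is exactly N + 1. Then k more applications at
  -- least double the weight, since each φⁿ⁺ᵏ(b) is as long as φⁿ(0) and φⁿ(1) together.
  scale : ∀ N → ∃ λ n → suc N ≤ weight (pow φ n) × weight (pow φ n) ≤ C′ * suc N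
  scale zero    = 0 , s≤s z≤n , ≤-trans (m≤n+m 2 (weight φ ^ k)) (≤-reflexive (sym (*-identityʳ C′)))
  scale (suc N) = go (scale N)
    where
    go : (∃ λ n → suc N ≤ weight (pow φ n) × weight (pow φ n) ≤ C′ * suc N) →
         ∃ λ n → suc (suc N) ≤ weight (pow φ n) × weight (pow φ n) ≤ C′ * suc (suc N)
    go (n , lo , hi) with suc (suc N) ≤? weight (pow φ n)
    ... | yes lo′ = n , lo′ , ≤-trans hi (*-monoʳ-≤ C′ (n≤1+n (suc N)))
    ... | no  ¬lo = k + n ,
      ≤-trans (≤-trans (+-monoʳ-≤ 1 lo) (+-monoˡ-≤ _ (≤-trans (s≤s z≤n) lo))) (≤-trans (+-mono-≤ (weight-≤-pow n false) (weight-≤-pow n true))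
        (≤-reflexive (cong (weight ∘ pow φ) (+-comm n k)))) ,
      ≤-trans (weight-pow-≤ k n) (≤-trans (*-monoʳ-≤ (weight φ ^ k) (≤-trans (≤-reflexive exact) (n≤1+n (suc N))))
        (*-monoˡ-≤ (suc (suc N)) (m≤m+n (weight φ ^ k) 2)))
      where
      exact : weight (pow φ n) ≡ suc N
      exact = ≤-antisym (s≤s⁻¹ (≰⇒> ¬lo)) lo

  Pairs : ℕ → Set
  Pairs n = ∀ a b → L (a ∷ b ∷ []) → a ∷ b ∷ [] ⊑ pref u n

  ¬¬-pairs : ¬ ¬ ∃ Pairs
  ¬¬-pairs = ¬¬-uniform (λ a n → ∀ b → Q a b n) (λ a m≤n q b → mono a b m≤n (q b))
    λ a → ¬¬-uniform (Q a) (mono a) λ b none →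
      -- The bound 0 is right if ab is not a factor; an occurrence, should one be given, supplies
      -- its own bound.
      none (0 , λ { (x , p) → ⊥-elim (none (length (x ++ a ∷ b ∷ []) , λ _ → x , [] , trans p (cong (x ++_) (sym (++-identityʳ _))))) })
    where
    Q : Bool → Bool → ℕ → Set
    Q a b n = L (a ∷ b ∷ []) → a ∷ b ∷ [] ⊑ pref u n
    mono : ∀ a b {m n} → m ≤ n → Q a b m → Q a b n
    mono a b m≤n q l = ⊑-trans (q l) (≼⇒⊑ (pref-mono m≤n))

  L⇒⊑img : ∀ n {w} → L w → ∃₂ λ a b → ∃ λ v → L (a ∷ b ∷ v) × w ⊑ img (pow φ n) (a ∷ b ∷ v)
  L⇒⊑img n {w} (x , p) = go (pref u (2 + length (x ++ w))) (length-pref u (2 + length (x ++ w))) (pfx-pref (2 + length (x ++ w)))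
    where
    go : ∀ y → length y ≡ 2 + length (x ++ w) → Pfx y → ∃₂ λ a b → ∃ λ v → L (a ∷ b ∷ v) × w ⊑ img (pow φ n) (a ∷ b ∷ v)
    go (a ∷ b ∷ v) le py = a , b , v , pfx⇒L py , ⊑-trans (⊑-++ˡ x ⊑-refl) (≼⇒⊑ (pfx-ordered p (pfx-pow n py)
      (≤-trans (≤-trans (m≤n+m _ 2) (≤-reflexive (sym le))) (length-img-≥ (pow φ n) (pow-nonerasing n) (a ∷ b ∷ v)))))

  module Recurrent (pairs : ∃ Pairs)
    (pals : InfinitelyManyFactors IsPalindrome u) (antipals : InfinitelyManyFactors IsAntipalindrome u)
    (aperiodic : IsAperiodic u) where

    -- φʲ(c) contains all two-letter factors for each c: they lie in a prefix of u inside some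
    -- φⁿ⁺ᵏ(u₀), which is a factor of φⁿ⁺²ᵏ(c).
    j : ℕ
    j = (proj₁ (scale (proj₁ pairs)) + k) + k

    pair-⊑ : ∀ a b c → L (a ∷ b ∷ []) → a ∷ b ∷ [] ⊑ pow φ j c
    pair-⊑ a b c l = ⊑-trans (proj₂ pairs a b l) (⊑-trans
      (≼⇒⊑ (pfx-ordered (pfx-pref (proj₁ pairs)) (pfx-pow-first (n + k))
        (≤-trans (≤-reflexive (length-pref u (proj₁ pairs))) (≤-trans (n≤1+n _) (≤-trans (proj₁ (proj₂ (scale (proj₁ pairs)))) (weight-≤-pow n (u 0)))))))
      (pow-⊑ (n + k) (u 0) c))
      where
      n = proj₁ (scale (proj₁ pairs))

    C″ : ℕ
    C″ = weight φ ^ (k + j) * C′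

    -- Linear recurrence: where blocks have length at least N + 1, a factor lies in two consecutive
    -- ones, and each admissible pair of blocks occurs j levels higher. Uniform recurrence,
    -- decidability of `L` and linear complexity all rest on this.
    cover : ∀ N → ∃ λ n → (∀ w → L w → length w ≤ suc N → ∀ c → w ⊑ pow φ n c) × weight (pow φ n) ≤ C″ * suc N
    cover N = (m + k) + j , occurs , bound
      where
      m : ℕ
      m = proj₁ (scale N)
      occurs : ∀ w → L w → length w ≤ suc N → ∀ c → w ⊑ pow φ ((m + k) + j) c
      occurs w l w≤N c =
        let a , b , v , lv , w⊑ = L⇒⊑img (m + k) l
            d , e , de⊑ , w⊑de = two-blocks (pow φ (m + k)) (suc N)
              (λ b → ≤-trans (proj₁ (proj₂ (scale N))) (weight-≤-pow m b)) a b v w w⊑ w≤N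
        in subst (w ⊑_) (sym (pow-+ φ (m + k) j c)) (⊑-trans w⊑de (img-mono-⊑ (pow φ (m + k)) (pair-⊑ d e c (L-⊑ de⊑ lv))))
      bound : weight (pow φ ((m + k) + j)) ≤ C″ * suc N
      bound = begin
        weight (pow φ ((m + k) + j))                 ≡⟨ cong (weight ∘ pow φ) (trans (+-assoc m k j) (+-comm m (k + j))) ⟩
        weight (pow φ ((k + j) + m))                 ≤⟨ weight-pow-≤ (k + j) m ⟩
        weight φ ^ (k + j) * weight (pow φ m)        ≤⟨ *-monoʳ-≤ (weight φ ^ (k + j)) (proj₂ (proj₂ (scale N))) ⟩
        weight φ ^ (k + j) * (C′ * suc N)            ≡⟨ sym (*-assoc (weight φ ^ (k + j)) C′ (suc N)) ⟩
        C″ * suc N                                   ∎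
        where open ≤-Reasoning

    uniform-recurrence : ∀ w → L w → ∃ λ M → ∀ v → L v → M ≤ length v → w ⊑ v
    uniform-recurrence w l = weight θ + weight θ , λ v lv le →
      let a , b , x , _ , v⊑ = L⇒⊑img n lv
          c , θc⊑v = contains-block θ (≤-trans (pow-nonerasing n false) (m≤m+n _ _)) (a ∷ b ∷ x) v v⊑ le
      in ⊑-trans (proj₁ (proj₂ (cover (length w))) w l (n≤1+n _) c) θc⊑v
      where
      n : ℕ
      n = proj₁ (cover (length w))
      θ : Morphism
      θ = pow φ n

    -- A long ρ-invariant factor contains w by uniform recurrence, hence also ρ(w).
    L-anti : ∀ ρ → Anti ρ → InfinitelyManyFactors (λ w → ρ w ≡ w) u → ∀ {w} → L w → L (ρ w)
    L-anti ρ anti inf {w} l =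
      let M , occurs = uniform-recurrence w l
          v , M≤v , factor , ρv≡v = inf M
          lv = factor⇒L {v} factor
      in L-⊑ (subst (ρ w ⊑_) ρv≡v (anti-mono-⊑ ρ anti (occurs v lv M≤v))) lv

    L-R : ∀ {w} → L w → L (R w)
    L-R = L-anti R reverse-++ pals

    L-E : ∀ {w} → L w → L (E w)
    L-E = L-anti E E-anti antipals

    L-bar : ∀ {w} → L w → L (bar w)
    L-bar {w} l = subst L (reverse-involutive (bar w)) (L-R (L-E l))

    L-previous : ∀ {w} → L w → ∃ λ a → L (a ∷ w)
    L-previous {w} l = let a , l′ = L-next (L-R l) in
      a , subst L (trans (reverse-++ (reverse w) [ a ]) (cong (a ∷_) (reverse-involutive w))) (L-R l′)

    L? : ∀ w → Dec (L w)
    L? w = go (w ∈? windows (length w) G)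
      where
      n : ℕ
      n = proj₁ (cover (length w))
      G : Word
      G = pow φ n (u 0)
      go : Dec (w ∈ windows (length w) G) → Dec (L w)
      go (yes w∈) = yes (L-⊑ (∈-windows⇒⊑ (length w) G w∈) (pfx⇒L (pfx-pow-first n)))
      go (no ¬w∈) = no λ l → ¬w∈ (⊑⇒∈-windows (proj₁ (proj₂ (cover (length w))) w l (n≤1+n _) (u 0)))

    complexity : ∀ n → 1 ≤ n → sumW n (λ w → if does (L? w) then 1 else 0) ≤ suc C″ * n
    complexity (suc N) _ = begin
      sumW (suc N) (λ w → if does (L? w) then 1 else 0) ≤⟨ sumW-mono (suc N) pointwise ⟩
      sumW (suc N) (multiplicity vs)                 ≤⟨ sumW-multiplicity-≤ (suc N) vs ⟩
      length vs                                      ≡⟨ length-windows (suc N) G ⟩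
      suc (length G)                                 ≤⟨ +-mono-≤ (s≤s z≤n) (≤-trans (length-≤-weight (pow φ n) (u 0)) (proj₂ (proj₂ (cover N)))) ⟩
      suc N + C″ * suc N                             ∎
      where
      open ≤-Reasoning
      n : ℕ
      n = proj₁ (cover N)
      G : Word
      G = pow φ n (u 0)
      vs : List Word
      vs = windows (suc N) G
      pointwise : ∀ w → length w ≡ suc N → (if does (L? w) then 1 else 0) ≤ multiplicity vs w
      pointwise w le with L? w
      ... | no _  = z≤n
      ... | yes l = multiplicity-∈ (subst (λ n → w ∈ windows n G) le
            (⊑⇒∈-windows (proj₁ (proj₂ (cover N)) w l (≤-reflexive le) (u 0))))

    open Special L L-⊑ L-previous L-bar L? (suc C″) complexity public

    -- If left special words were all shorter than n, then by reversal each n-letter factor would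
    -- determine the letter after it, and a return of the n-letter prefix would make u periodic.
    long-left-special : ∀ n → ¬ ¬ ∃ λ w → LS w × n ≤ length w
    long-left-special n none = aperiodic (periodic (u 0 ∷ a) n ∷≢[] returns)
      where
      p : Word
      p = pref u n
      M : ℕ
      M = proj₁ (uniform-recurrence p (pfx⇒L (pfx-pref n)))
      -- The prefix is sought after the first letter of u, so that the period is positive.
      tail = pref-∷ M
      p⊑ : p ⊑ proj₁ tail
      p⊑ = proj₂ (uniform-recurrence p (pfx⇒L (pfx-pref n))) (proj₁ tail)
        ([ u 0 ] , subst Pfx (proj₁ (proj₂ tail)) (pfx-pref (suc M))) (≤-reflexive (sym (proj₂ (proj₂ tail))))
      a : Word
      a = proj₁ p⊑
      start : Pfx ((u 0 ∷ a) ++ p)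
      start = pfx-++ ((u 0 ∷ a) ++ p) (subst Pfx
        (trans (proj₁ (proj₂ tail)) (trans (cong (u 0 ∷_) (proj₂ (proj₂ p⊑))) (sym (++-assoc (u 0 ∷ a) p _)))) (pfx-pref (suc M)))
      deterministic : ∀ w → length w ≡ n → ∀ c d → L (w ++ [ c ]) → L (w ++ [ d ]) → c ≡ d
      deterministic w le c d lc ld with c Bool.≟ d
      ... | yes c≡d = c≡d
      ... | no c≢d = ⊥-elim (none (R w , special , ≤-reflexive (sym (trans (length-reverse w) le))))
        where
        reversed : ∀ b → L (w ++ [ b ]) → L (b ∷ R w)
        reversed b l = subst L (reverse-++ w [ b ]) (L-R l)
        special : LS (R w)
        special b with c Bool.≟ b
        ... | yes refl = reversed c lc
        ... | no c≢b = subst (λ b → L (b ∷ R w)) (trans (≢⇒≡not c≢d) (sym (≢⇒≡not c≢b))) (reversed d ld)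
      returns-+ : ∀ m → Pfx ((u 0 ∷ a) ++ pref u (m + n))
      returns-+ zero    = start
      returns-+ (suc m) = step (returns-+ m) (splitAtʷ m (pref u (m + n)) (≤-trans (m≤m+n m n) (≤-reflexive (sym (length-pref u (m + n))))))
        where
        step : Pfx ((u 0 ∷ a) ++ pref u (m + n)) → (∃₂ λ x w → pref u (m + n) ≡ x ++ w × length x ≡ m) →
               Pfx ((u 0 ∷ a) ++ pref u (m + n) ++ [ u (m + n) ])
        step pf (x , w , eq , |x|) = subst (λ c → Pfx ((u 0 ∷ a) ++ pref u (m + n) ++ [ c ])) (sym same)
          (subst Pfx (++-assoc (u 0 ∷ a) (pref u (m + n)) _) (pfx-next pf))
          where
          d : Bool
          d = u (length ((u 0 ∷ a) ++ pref u (m + n)))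
          |w| : length w ≡ n
          |w| = +-cancelˡ-≡ m _ _ (trans (cong (_+ length w) (sym |x|)) (trans (sym (length-++ x)) (trans (cong length (sym eq)) (length-pref u (m + n)))))
          same : u (m + n) ≡ d
          same = deterministic w |w| _ _
            (x , subst Pfx (trans (cong (_++ [ u (m + n) ]) eq) (++-assoc x w _)) (pfx-pref (suc (m + n))))
            ((u 0 ∷ a) ++ x , subst Pfx (trans (cong (λ v → ((u 0 ∷ a) ++ v) ++ [ d ]) eq)
              (trans (cong (_++ [ d ]) (sym (++-assoc (u 0 ∷ a) x w))) (++-assoc ((u 0 ∷ a) ++ x) w [ d ]))) (pfx-next pf))
      returns : ∀ m → n ≤ m → Pfx ((u 0 ∷ a) ++ pref u m)
      returns m n≤m = subst (λ m → Pfx ((u 0 ∷ a) ++ pref u m)) (m∸n+n≡m n≤m) (returns-+ (m ∸ n))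

  -- φ(u₀) commutes with every φ(w), so the prefix φ(u₀)φ(w) of u also begins with φ(w); hence u =
  -- φ(u₀)u.
  commuting⇒periodic : φ false ++ φ true ≡ φ true ++ φ false → IsEventuallyPeriodic u
  commuting⇒periodic comm = periodic (φ (u 0)) 0 φ≢[] λ m _ → pre m (pref-∷ m)
    where
    φ≢[] : φ (u 0) ≢ []
    φ≢[] e = <⇒≢ (nonerasing (u 0)) (sym (cong length e))
    commute : ∀ c d → φ c ++ φ d ≡ φ d ++ φ c
    commute false false = refl
    commute false true  = comm
    commute true  false = sym comm
    commute true  true  = refl
    commute-img : ∀ c w → φ c ++ img φ w ≡ img φ w ++ φ c
    commute-img c []      = ++-identityʳ (φ c)
    commute-img c (d ∷ w) = trans (sym (++-assoc (φ c) (φ d) (img φ w))) (trans (cong (_++ img φ w) (commute c d))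
      (trans (++-assoc (φ d) (φ c) (img φ w)) (trans (cong (φ d ++_) (commute-img c w)) (sym (++-assoc (φ d) (img φ w) (φ c))))))
    pre : ∀ m → (∃ λ w → pref u (suc m) ≡ u 0 ∷ w × length w ≡ m) → Pfx (φ (u 0) ++ pref u m)
    pre m (w , eq , |w|) = pfx-≼ (++-mono-≼ (φ (u 0)) (pfx-ordered (pfx-pref m) short
        (≤-trans (≤-reflexive (trans (length-pref u m) (sym |w|))) (length-img-≥ φ nonerasing w)))) long
      where
      long : Pfx (φ (u 0) ++ img φ w)
      long = pfx-img (subst Pfx eq (pfx-pref (suc m)))
      short : Pfx (img φ w)
      short = pfx-++ (img φ w) (subst Pfx (commute-img (u 0) w) long)

-- Assembling the symmetries

ΘW-injective : ∀ v w → ΘW v ≡ ΘW w → v ≡ w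
ΘW-injective []          []          _  = refl
ΘW-injective (false ∷ v) (false ∷ w) eq = cong (false ∷_) (ΘW-injective v w (∷-injectiveʳ (∷-injectiveʳ eq)))
ΘW-injective (true ∷ v)  (true ∷ w)  eq = cong (true ∷_) (ΘW-injective v w (∷-injectiveʳ (∷-injectiveʳ eq)))
ΘW-injective []          (false ∷ w) ()
ΘW-injective []          (true ∷ w)  ()
ΘW-injective (false ∷ v) []          ()
ΘW-injective (true ∷ v)  []          ()
ΘW-injective (false ∷ v) (true ∷ w)  ()
ΘW-injective (true ∷ v)  (false ∷ w) ()

-- E fixes 01 and 10, whereas R exchanges them; thus Θ turns each of the two symmetries into the
-- other.
E-ΘW : ∀ w → E (ΘW w) ≡ ΘW (R w)
E-ΘW w = begin
  E (img Θ w)                      ≡⟨ cong (E ∘ img Θ) (sym (reverse-involutive w)) ⟩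
  E (img Θ (R (R w)))              ≡⟨ sym (img-anti E E-anti Θ (R w)) ⟩
  img (λ b → E (Θ b)) (R w)        ≡⟨ img-cong (λ { false → refl ; true → refl }) (R w) ⟩
  ΘW (R w)                         ∎
  where open ≡-Reasoning

R-ΘW : ∀ w → R (ΘW w) ≡ ΘW (E w)
R-ΘW w = begin
  R (ΘW w)                         ≡⟨ cong R (sym (bar-involutive (ΘW w))) ⟩
  E (bar (ΘW w))                   ≡⟨ cong E (sym (ΘW-bar w)) ⟩
  E (ΘW (bar w))                   ≡⟨ E-ΘW (bar w) ⟩
  ΘW (E w)                         ∎
  where open ≡-Reasoning

alternate : Word → Word → ℕ → Word
alternate x y k = x ++ (y ++ x) ^ʷ k

bar-alternate : ∀ x y k → bar (alternate x y k) ≡ alternate (bar x) (bar y) k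
bar-alternate x y k = trans (bar-++ x _) (cong (bar x ++_) (trans (bar-^ʷ (y ++ x) k) (cong (_^ʷ k) (bar-++ y x))))

img-alternate : ∀ χ x y k → img χ (alternate x y k) ≡ alternate (img χ x) (img χ y) k
img-alternate χ x y k = trans (img-++ χ x _) (cong (img χ x ++_) (trans (img-^ʷ χ (y ++ x) k) (cong (_^ʷ k) (img-++ χ y x))))

alternate-++ : ∀ x y k h → alternate x y k ++ alternate y x h ≡ (x ++ y) ^ʷ suc (k + h)
alternate-++ x y k h = begin
  (x ++ (y ++ x) ^ʷ k) ++ y ++ (x ++ y) ^ʷ h   ≡⟨ cong (_++ y ++ (x ++ y) ^ʷ h) (sym (^ʷ-slide x y k)) ⟩
  ((x ++ y) ^ʷ k ++ x) ++ y ++ (x ++ y) ^ʷ h   ≡⟨ ++-assoc ((x ++ y) ^ʷ k) x _ ⟩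
  (x ++ y) ^ʷ k ++ x ++ y ++ (x ++ y) ^ʷ h     ≡⟨ cong ((x ++ y) ^ʷ k ++_) (sym (++-assoc x y _)) ⟩
  (x ++ y) ^ʷ k ++ (x ++ y) ^ʷ suc h           ≡⟨ sym (^ʷ-+ (x ++ y) k (suc h)) ⟩
  (x ++ y) ^ʷ (k + suc h)                      ≡⟨ cong ((x ++ y) ^ʷ_) (+-suc k h) ⟩
  (x ++ y) ^ʷ suc (k + h)                      ∎
  where open ≡-Reasoning

-- Stable under `_′` and under complementation, so the reductions to χ and to the longer image can
-- be undone. The word v̄ equals R(v) when E(v) = v but differs from it when R(v) = v; squaring
-- handles both.
Symmetric : Morphism → Set
Symmetric φ = ∃ λ v → ∃₂ λ k h → v ≢ [] × (R v ≡ v ⊎ E v ≡ v) ×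
  φ false ≡ ΘW (alternate v (bar v) k) × φ true ≡ ΘW (alternate (bar v) v h)

unbar : ∀ {w} x y k → bar w ≡ ΘW (alternate x y k) → w ≡ ΘW (alternate (bar x) (bar y) k)
unbar {w} x y k eq = trans (sym (bar-involutive w)) (trans (cong bar eq)
  (trans (sym (ΘW-bar (alternate x y k))) (cong ΘW (bar-alternate x y k))))

symmetric-′ : ∀ φ → Symmetric (φ ′) → Symmetric φ
symmetric-′ φ (v , k , h , v≢[] , s , φ0 , φ1) = v , h , k , v≢[] , s ,
  trans (unbar (bar v) v h φ1) (cong (λ w → ΘW (alternate w (bar v) h)) (bar-involutive v)) ,
  trans (unbar v (bar v) k φ0) (cong (λ w → ΘW (alternate (bar v) w k)) (bar-involutive v))

symmetric-bar : ∀ φ → Symmetric (bar ∘ φ) → Symmetric φ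
symmetric-bar φ (v , k , h , v≢[] , s , φ0 , φ1) = bar v , k , h , v≢[] ∘ bar-injective {v} {[]} , sym-bar s ,
  unbar v (bar v) k φ0 , unbar (bar v) v h φ1
  where
  sym-bar : R v ≡ v ⊎ E v ≡ v → R (bar v) ≡ bar v ⊎ E (bar v) ≡ bar v
  sym-bar (inj₁ r) = inj₁ (trans (reverse-bar v) (cong bar r))
  sym-bar (inj₂ e) = inj₂ (trans (E-bar v) (cong bar e))

-- With n = k + h + 1 we have φ ∘ Θ = Θ ∘ ζ for ζ(0) = (vv̄)ⁿ and ζ(1) = (v̄v)ⁿ, so φ² has
-- the required form with 𝔴 = ζ(v), an antipalindrome for either symmetry of v.
symmetric⇒A₂ : ∀ φ → Symmetric φ → InA2WithAntipalindrome (pow φ 2)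
symmetric⇒A₂ φ (v , k , h , v≢[] , s , φ0 , φ1) = W , k , h , W≢[] , EW≡W ,
  trans (square false (alternate v (bar v) k) φ0) (cong ΘW (trans (img-alternate ζ v (bar v) k)
    (cong (λ x → alternate W x k) ζv̄≡RW))) ,
  trans (square true (alternate (bar v) v h) φ1) (cong ΘW (trans (img-alternate ζ (bar v) v h)
    (trans (cong (λ x → alternate x W h) ζv̄≡RW) (sym (^ʷ-slide (R W) W h)))))
  where
  n : ℕ
  n = suc (k + h)
  ζ : Morphism
  ζ b = if b then (bar v ++ v) ^ʷ n else (v ++ bar v) ^ʷ n
  W : Word
  W = img ζ v
  φΘ : ∀ b → img φ (Θ b) ≡ ΘW (ζ b)
  φΘ false = trans (img-pair φ false true) (trans (cong₂ _++_ φ0 φ1)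
    (trans (sym (img-++ Θ (alternate v (bar v) k) (alternate (bar v) v h))) (cong ΘW (alternate-++ v (bar v) k h))))
  φΘ true  = trans (img-pair φ true false) (trans (cong₂ _++_ φ1 φ0)
    (trans (sym (img-++ Θ (alternate (bar v) v h) (alternate v (bar v) k))) (cong ΘW (trans (alternate-++ (bar v) v h k)
      (cong (λ m → (bar v ++ v) ^ʷ suc m) (+-comm h k))))))
  square : ∀ b z → φ b ≡ ΘW z → pow φ 2 b ≡ ΘW (img ζ z)
  square b z eq = trans (cong (img φ) (trans (img-letter φ b) eq))
    (trans (img-∘ φ Θ z) (trans (img-cong φΘ z) (sym (img-∘ Θ ζ z))))
  ζ-not : ∀ b → ζ (not b) ≡ bar (ζ b)
  ζ-not false = sym (trans (bar-^ʷ (v ++ bar v) n) (cong (_^ʷ n) (trans (bar-++ v (bar v)) (cong (bar v ++_) (bar-involutive v)))))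
  ζ-not true  = sym (trans (bar-^ʷ (bar v ++ v) n) (cong (_^ʷ n) (trans (bar-++ (bar v) v) (cong (_++ bar v) (bar-involutive v)))))
  ζ-bar : ∀ z → img ζ (bar z) ≡ bar (img ζ z)
  ζ-bar z = trans (img-bar ζ z) (trans (img-cong ζ-not z) (sym (bar-img ζ z)))
  E-img : ∀ z → E (img ζ z) ≡ img (λ b → E (ζ b)) (R z)
  E-img z = trans (cong (E ∘ img ζ) (sym (reverse-involutive z))) (sym (img-anti E E-anti ζ (R z)))
  EW : R v ≡ v ⊎ E v ≡ v → E W ≡ W
  -- Here E fixes ζ(0) and ζ(1), so E(ζ(v)) = ζ(R(v)).
  EW (inj₁ Rv≡v) = trans (E-img v) (trans (img-cong Eζ (R v)) (cong (img ζ) Rv≡v))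
    where
    Ev≡v̄ : E v ≡ bar v
    Ev≡v̄ = trans (reverse-bar v) (cong bar Rv≡v)
    Ev̄≡v : E (bar v) ≡ v
    Ev̄≡v = trans (E-bar v) (trans (cong bar Ev≡v̄) (bar-involutive v))
    Eζ : ∀ b → E (ζ b) ≡ ζ b
    Eζ false = trans (anti-^ʷ E E-anti (v ++ bar v) n) (cong (_^ʷ n) (trans (E-anti v (bar v)) (cong₂ _++_ Ev̄≡v Ev≡v̄)))
    Eζ true  = trans (anti-^ʷ E E-anti (bar v ++ v) n) (cong (_^ʷ n) (trans (E-anti (bar v) v) (cong₂ _++_ Ev≡v̄ Ev̄≡v)))
  -- Here E exchanges ζ(0) and ζ(1), so E(ζ(v)) = ζ(E(v)).
  EW (inj₂ Ev≡v) = trans (E-img v) (trans (img-cong Eζ (R v)) (trans (sym (img-bar ζ (R v)))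
    (cong (img ζ) (trans (sym (reverse-bar v)) Ev≡v))))
    where
    Ev̄≡v̄ : E (bar v) ≡ bar v
    Ev̄≡v̄ = trans (E-bar v) (cong bar Ev≡v)
    Eζ : ∀ b → E (ζ b) ≡ ζ (not b)
    Eζ false = trans (anti-^ʷ E E-anti (v ++ bar v) n) (cong (_^ʷ n) (trans (E-anti v (bar v)) (cong₂ _++_ Ev̄≡v̄ Ev≡v)))
    Eζ true  = trans (anti-^ʷ E E-anti (bar v ++ v) n) (cong (_^ʷ n) (trans (E-anti (bar v) v) (cong₂ _++_ Ev≡v Ev̄≡v̄)))
  EW≡W : E W ≡ W
  EW≡W = EW s
  ζv̄≡RW : img ζ (bar v) ≡ R W
  ζv̄≡RW = trans (ζ-bar v) (trans (cong bar (sym EW≡W)) (trans (cong bar (reverse-bar W)) (bar-involutive (R W))))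
  1≤v : 1 ≤ length v
  1≤v = subst (λ w → 1 ≤ length w) (++-identityʳ v) (length-<-++ˡ v≢[] [])
  1≤ζ : ∀ b → 1 ≤ length (ζ b)
  1≤ζ false = ≤-trans 1≤v (≤-trans (length-++-≤ˡ v) (length-++-≤ˡ (v ++ bar v)))
  1≤ζ true  = ≤-trans 1≤v (≤-trans (length-++-≤ʳ v {bar v}) (length-++-≤ˡ (bar v ++ v)))
  W≢[] : W ≢ []
  W≢[] e = <⇒≱ 1≤v (≤-trans (length-img-≥ ζ 1≤ζ v) (≤-reflexive (cong length e)))

no-square : ∀ m x a y → (false ∷ true ∷ []) ^ʷ m ≢ x ++ a ∷ a ∷ y
no-square zero          []          a     y ()
no-square zero          (c ∷ x)     a     y ()
no-square (suc m)       []          false y ()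
no-square (suc m)       []          true  y ()
no-square (suc zero)    (c ∷ [])    a     y ()
no-square (suc (suc m)) (c ∷ [])    false y ()
no-square (suc (suc m)) (c ∷ [])    true  y ()
no-square (suc m)       (c ∷ d ∷ x) a     y eq = no-square m x a y (∷-injectiveʳ (∷-injectiveʳ eq))

Monochrome : Word → Set
Monochrome w = ∃ λ a → All (_≡ a) w

monochrome-bar : ∀ {w} → Monochrome (bar w) → Monochrome w
monochrome-bar {w} (a , all) = not a , All.map (λ eq → trans (sym (not-involutive _)) (cong not eq)) (All.map⁻ all)

monochrome⇒¬primitive : ∀ φ → (∀ b → Monochrome (φ b)) → ¬ IsPrimitive φ
monochrome⇒¬primitive φ mono (k , mix) = clash (powers k)
  where
  img-mono : ∀ {a w} → All (_≡ a) w → All (_≡ proj₁ (mono a)) (img φ w)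
  img-mono []           = []
  img-mono (refl ∷ all) = All.++⁺ (proj₂ (mono _)) (img-mono all)
  powers : ∀ n → Monochrome (pow φ n false)
  powers zero    = false , refl ∷ []
  powers (suc n) = proj₁ (mono (proj₁ (powers n))) , img-mono (proj₂ (powers n))
  clash : ¬ Monochrome (pow φ k false)
  clash (a , all) = case trans (All.lookup all (mix false false)) (sym (All.lookup all (mix false true))) of λ ()

bar-noncommuting : ∀ χ → NonCommuting χ → NonCommuting (bar ∘ χ)
bar-noncommuting χ nc eq = nc (bar-injective (trans (bar-++ (χ false) (χ true)) (trans eq (sym (bar-++ (χ true) (χ false))))))

′-noncommuting : ∀ χ → NonCommuting χ → NonCommuting (χ ′)
′-noncommuting χ nc eq = nc (bar-injective (trans (bar-++ (χ false) (χ true)) (trans (sym eq) (sym (bar-++ (χ true) (χ false))))))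

-- The set of prefixes to which `Marked` is applied. `Limit` depends on a proof of `∃ Pairs`,
-- available only under double negation; this set is defined outright and is shown to lie in `Limit`
-- once such a proof is given.
data Orbit (χ : Morphism) (c : Bool) : Word → Set where
  letter : Orbit χ c [ c ]
  apply  : ∀ {v} → Orbit χ c v → Orbit χ c (img χ v)
  apply′ : ∀ {v} → Orbit χ c v → Orbit χ c (img (χ ′) v)
  prefix : ∀ {v w} → v ≼ w → Orbit χ c w → Orbit χ c v

Fixes : Morphism → Set
Fixes χ = ∀ b → Starts b (χ b)

fixes-′ : ∀ χ → Fixes χ → Fixes (χ ′)
fixes-′ χ fix b = subst (λ a → Starts a ((χ ′) b)) (not-involutive b) (starts-bar (fix (not b)))

module Main (φ : Morphism) (u : InfWord) (primitive′ : IsPrimitive φ)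
  (fixed : IsFixedPoint φ u) (aperiodic : IsAperiodic u)
  (pals : InfinitelyManyFactors IsPalindrome u) (antipals : InfinitelyManyFactors IsAntipalindrome u) where

  open FixedPoint φ u primitive′ fixed

  -- Uniform recurrence is only available under a double negation; this is enough, because
  -- what is derived from it below are negations and equalities of words.
  Preserves : Morphism → Set
  Preserves χ = NonCommuting χ × (∃ Pairs → ∀ {w} → L w → L (img χ w))

  module _ (pairs : ∃ Pairs) where
    open Recurrent pairs pals antipals aperiodic

    good : ∀ {χ} → Preserves χ → Good χ
    good (nc , pres) = record { preserves = pres pairs ; noncommuting = nc }

    first-letters-differ : ∀ χ → Preserves χ → ∀ a → ¬ (Starts a (χ false) × Starts a (χ true))
    first-letters-differ χ p = first-letters long-left-special χ (good p)

    bar-closed : ∀ {w} → L w → L (bar w)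
    bar-closed = L-bar

    R-closed : ∀ {w} → L w → L (R w)
    R-closed = L-R

    orbit⇒limit : ∀ χ → Preserves χ → Preserves (χ ′) → Fixes χ → ∀ {c v} → Orbit χ c v → Limit long-left-special c v
    orbit⇒limit χ p p′ fix {c} letter     = limit-[_] long-left-special c
    orbit⇒limit χ p p′ fix (apply o)      = limit-img long-left-special χ (good p) fix (orbit⇒limit χ p p′ fix o)
    orbit⇒limit χ p p′ fix (apply′ o)     = limit-img long-left-special (χ ′) (good p′) (fixes-′ χ fix) (orbit⇒limit χ p p′ fix o)
    orbit⇒limit χ p p′ fix (prefix v≼w o) = limit-≼ long-left-special v≼w (orbit⇒limit χ p p′ fix o)

    orbits-agree : ∀ χ ψ → Preserves χ → Preserves (χ ′) → Fixes χ → Preserves ψ → Preserves (ψ ′) → Fixes ψ →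
                   ∀ {c v w} → Orbit χ c v → Orbit ψ c w → Comparable v w
    orbits-agree χ ψ p p′ f q q′ g o o′ = limit-comparable long-left-special (orbit⇒limit χ p p′ f o) (orbit⇒limit ψ q q′ g o′)

    -- Uniform recurrence would place every factor inside some (01)ᵐ, so 00 and 11 would not occur
    -- and u would have period 2.
    not-alternating : (P : Word → Set) → (∀ {w} → P w → L w) → ¬ (∀ n → ∃ λ m → n ≤ m × P ((false ∷ true ∷ []) ^ʷ m))
    not-alternating P P⇒L unbounded = aperiodic (2 , 0 , s≤s z≤n , λ i _ →
      trans (cong u (+-comm i 2)) (trans (flip (suc i)) (trans (cong not (flip i)) (not-involutive (u i)))))
      where
      aa∉L : ∀ a → ¬ L (a ∷ a ∷ [])
      aa∉L a l =
        let M , occurs = uniform-recurrence (a ∷ a ∷ []) l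
            m , M≤m , p = unbounded M
            x , y , eq = occurs ((false ∷ true ∷ []) ^ʷ m) (P⇒L p) (≤-trans M≤m (long m))
        in no-square m x a y eq
        where
        long : ∀ m → m ≤ length ((false ∷ true ∷ []) ^ʷ m)
        long zero    = z≤n
        long (suc m) = s≤s (m≤n⇒m≤1+n (long m))
      flip : ∀ i → u (suc i) ≡ not (u i)
      flip i = ≢⇒≡not λ eq → aa∉L (u i) (subst (λ b → L (u i ∷ b ∷ [])) (sym eq) (L-pair i))

  preserves-φ : Preserves φ
  preserves-φ = aperiodic ∘ commuting⇒periodic , λ _ → L-φ

  preserves-bar : ∀ χ → Preserves χ → Preserves (bar ∘ χ)
  preserves-bar χ (nc , pres) = bar-noncommuting χ nc , λ J {w} l → subst L (bar-img χ w) (bar-closed J (pres J l))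

  preserves-′ : ∀ χ → Preserves χ → Preserves (χ ′)
  preserves-′ χ (nc , pres) = ′-noncommuting χ nc , λ J {w} l → subst L (sym (img-′ χ w)) (bar-closed J (pres J (bar-closed J l)))

  preserves-rev : ∀ χ → Preserves χ → Preserves (rev χ)
  preserves-rev χ (nc , pres) = rev-noncommuting χ nc , λ J {w} l → subst L (sym (img-rev χ w)) (R-closed J (pres J (R-closed J l)))

  fixes-letters : ∀ χ → Preserves χ → Fixes χ ⊎ Fixes (bar ∘ χ)
  fixes-letters χ p = go (χ false) (χ true) refl refl
    where
    nonempty : ∀ b → 1 ≤ length (χ b)
    nonempty = noncommuting⇒nonerasing χ (proj₁ p)
    differ : ∀ a → ¬ (Starts a (χ false) × Starts a (χ true))
    differ a s = ¬¬-pairs λ J → first-letters-differ J χ p a s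
    go : ∀ x y → χ false ≡ x → χ true ≡ y → Fixes χ ⊎ Fixes (bar ∘ χ)
    go []          _           eq _  = ⊥-elim (<⇒≱ (nonempty false) (≤-reflexive (cong length eq)))
    go (_ ∷ _)     []          _  eq = ⊥-elim (<⇒≱ (nonempty true) (≤-reflexive (cong length eq)))
    go (false ∷ x) (true ∷ y)  e₀ e₁ = inj₁ λ { false → x , e₀ ; true → y , e₁ }
    go (true ∷ x)  (false ∷ y) e₀ e₁ = inj₂ λ { false → bar x , cong bar e₀ ; true → bar y , cong bar e₁ }
    go (false ∷ x) (false ∷ y) e₀ e₁ = ⊥-elim (differ false ((x , e₀) , (y , e₁)))
    go (true ∷ x)  (true ∷ y)  e₀ e₁ = ⊥-elim (differ true ((x , e₀) , (y , e₁)))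

  module _ (χ : Morphism) (p : Preserves χ) (fix : Fixes χ) where

    comparable-orbits : ∀ ψ → Preserves ψ → Fixes ψ → ∀ {c v w} → Orbit χ c v → Orbit ψ c w → Comparable v w
    comparable-orbits ψ q fix′ {c} {v} {w} o o′ = decidable-stable (comparable? v w) λ ¬c → ¬¬-pairs λ J →
      ¬c (orbits-agree J χ ψ p (preserves-′ χ p) fix q (preserves-′ ψ q) fix′ o o′)

    same-images : ∀ ψ → Preserves ψ → Fixes ψ → (∀ b → length (χ b) ≡ length (ψ b)) → ∀ b → χ b ≡ ψ b
    same-images ψ q fix′ le b = comparable-≡ (subst₂ Comparable (img-letter χ b) (img-letter ψ b)
      (comparable-orbits ψ q fix′ {b} (apply letter) (apply letter))) (le b)

    orbit⇒L : ∃ Pairs → ∀ {c v} → Orbit χ c v → L v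
    orbit⇒L J {c} letter       = L-⊑ (∈⇒⊑ (mixing (u 0) c)) (pfx⇒L (pfx-pow-first k))
    orbit⇒L J (apply o)        = proj₂ p J (orbit⇒L J o)
    orbit⇒L J (apply′ o)       = proj₂ (preserves-′ χ p) J (orbit⇒L J o)
    orbit⇒L J (prefix v≼w o)   = L-⊑ (≼⇒⊑ v≼w) (orbit⇒L J o)

    not-monochrome : ((∀ b → Monochrome (χ b)) → ∀ b → Monochrome (φ b)) → ¬ (∀ b → Monochrome (χ b))
    not-monochrome χ⇒φ mono = monochrome⇒¬primitive φ (χ⇒φ mono) primitive′

    -- Whether the mirror image of χ or its complement keeps first letters decides between R and E
    -- as the symmetry ρ of the images. The first hypothesis carries single-letter images back to φ,
    -- for which primitivity is given.
    symmetric-if-shorter : ((∀ b → Monochrome (χ b)) → ∀ b → Monochrome (φ b)) → length (χ true) < length (χ false) → Symmetric χ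
    symmetric-if-shorter χ⇒φ shorter = by-reversal (fixes-letters (rev χ) (preserves-rev χ p))
      where
      mixed : ¬ (All (_≡ false) (χ false) × All (_≡ true) (χ true))
      mixed (m₀ , m₁) = not-monochrome χ⇒φ λ { false → false , m₀ ; true → true , m₁ }
      unbounded : ¬ (∀ n → ∃ λ m → n ≤ m × Orbit χ false ((false ∷ true ∷ []) ^ʷ m))
      unbounded alt = ¬¬-pairs λ J → not-alternating J (Orbit χ false) (orbit⇒L J) alt
      convert : ∀ ρ → (∀ w → ρ (ΘW w) ≡ ΘW w → R w ≡ w ⊎ E w ≡ w) →
        (∃ λ w → ∃₂ λ k h → w ≢ [] × ρ (ΘW w) ≡ ΘW w ×
          χ false ≡ ΘW (w ++ (bar w ++ w) ^ʷ k) × χ true ≡ ΘW ((bar w ++ w) ^ʷ h ++ bar w)) → Symmetric χ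
      convert ρ sym-w (w , k , h , w≢[] , ρw , χ0 , χ1) = w , k , h , w≢[] , sym-w w ρw , χ0 ,
        trans χ1 (cong ΘW (^ʷ-slide (bar w) w h))
      by-reversal : Fixes (rev χ) ⊎ Fixes (bar ∘ rev χ) → Symmetric χ
      by-reversal (inj₁ f) = convert R (λ w eq → inj₂ (ΘW-injective (E w) w (trans (sym (R-ΘW w)) eq)))
        (Marked.conclusion χ R reverse-++ reverse-bar length-reverse (Orbit χ false) prefix
          (comparable-orbits χ p fix) apply apply′ letter (fix false) (fix true)
          (λ b → sym (same-images (rev χ) (preserves-rev χ p) f (λ b → sym (length-reverse (χ b))) b))
          shorter mixed unbounded)
      by-reversal (inj₂ f) = convert E (λ w eq → inj₁ (ΘW-injective (R w) w (trans (sym (E-ΘW w)) eq)))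
        (Marked.conclusion χ E E-anti E-bar length-E (Orbit χ false) prefix
          (comparable-orbits χ p fix) apply apply′ letter (fix false) (fix true)
          (λ b → trans (reverse-bar (χ b)) (sym (same-images (bar ∘ rev χ) (preserves-bar (rev χ) (preserves-rev χ p)) f
            (λ b → sym (trans (length-bar (R (χ b))) (length-reverse (χ b)))) b)))
          shorter mixed unbounded)

  symmetric-fixing : ∀ χ → Preserves χ → Fixes χ → ((∀ b → Monochrome (χ b)) → ∀ b → Monochrome (φ b)) →
                     length (χ false) ≢ length (χ true) → Symmetric χ
  symmetric-fixing χ p fix χ⇒φ ≢ with <-cmp (length (χ false)) (length (χ true))
  ... | tri≈ _ eq _ = ⊥-elim (≢ eq)
  ... | tri> _ _ gt = symmetric-if-shorter χ p fix χ⇒φ gt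
  -- Conjugation exchanges the two lengths, so the image of 0 may be taken as the longer one.
  ... | tri< lt _ _ = symmetric-′ χ (symmetric-if-shorter (χ ′) (preserves-′ χ p) (fixes-′ χ fix)
        (λ mono → χ⇒φ λ b → monochrome-bar (subst (λ c → Monochrome (bar (χ c))) (not-involutive b) (mono (not b))))
        (subst₂ _<_ (sym (length-bar (χ false))) (sym (length-bar (χ true))) lt))

  symmetric : ¬ IsUniform φ → Symmetric φ
  symmetric nonuniform = go (fixes-letters φ preserves-φ)
    where
    go : Fixes φ ⊎ Fixes (bar ∘ φ) → Symmetric φ
    go (inj₁ f) = symmetric-fixing φ preserves-φ f (λ m → m) nonuniform
    go (inj₂ f) = symmetric-bar φ (symmetric-fixing (bar ∘ φ) (preserves-bar φ preserves-φ) f (λ m b → monochrome-bar (m b))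
      λ eq → nonuniform (trans (sym (length-bar (φ false))) (trans eq (length-bar (φ true)))))

theorem36 : (φ : Morphism) (u : InfWord) →
    IsPrimitive φ → ¬ IsUniform φ →
    IsFixedPoint φ u → IsAperiodic u →
    InfinitelyManyFactors IsPalindrome u →
    InfinitelyManyFactors IsAntipalindrome u →
    InA2WithAntipalindrome φ ⊎ InA2WithAntipalindrome (pow φ 2)
theorem36 φ u primitive′ nonuniform fixed aperiodic pals antipals =
  inj₂ (symmetric⇒A₂ φ (Main.symmetric φ u primitive′ fixed aperiodic pals antipals nonuniform))
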